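{- Let $m\ge1$ be an integer and $\epsilon\in(0,1)$. If $f$ is an $m$-submodular function, then there exists an online algorithm for the submodular $k$-secretary problem with shortlists that achieves a competitive ratio of $1-\epsilon$ using a shortlist of size $\eta_{\epsilon,m}(k)=(2m+3)\ln(2/\epsilon)=O(1)$.
   Context: A function $f$ on subsets of a ground set is $m$-submodular if it is submodular and there exists a submodular function $F$ such that $f(S)=\max_{T\subseteq S,|T|\le m}F(T)$ for all $S$. Submodular $k$-secretary problem with shortlists: a fixed but unknown set $\mathcal{U}$ of $n$ items ($n$ known) arrives in a uniformly random order; $f$ is a monotone submodular function on subsets of $\mathcal U$ accessible through a value oracle; in each round the algorithm irrevocably decides whether to add the arriving item to a shortlist $A$. $\mathrm{ALG}=\mathbb{E}[\max_{S\subseteq A,|S|\le k} f(S)]$, $\mathrm{OPT}=\max_{S\subseteq\mathcal U,|S|\le k} f(S)$. Competitive ratio $c$ with shortlist size $\eta(k)$ means $|A|\le\eta(k)$ always and $\mathrm{ALG}/\mathrm{OPT}\ge c$.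
   Formalization: The formal theorem assumes m ≤ k and f ≥ 0; for k < m the claim fails (m=3, k=2: f(∅)=0, singletons 1, pairs 3/2 except one hidden pair of value 2, larger sets 2 gives ratio tending to 3/4), and for f(∅) < 0 the ratio claim fails. -}

module Defs where

open import Algebra.Bundles using (CommutativeRing; Semiring)
open import Data.Bool.Base using (Bool; if_then_else_)
open import Data.Fin.Base using (Fin; punchIn)
open import Data.Fin.Subset using (Subset; inside; outside; ⊥; ⊤; ⁅_⁆; _∪_; _∩_; _⊆_; ∣_∣)
open import Data.Fin.Subset.Properties using (_⊆?_)
open import Data.List.Base as List using (List; []; _∷_; _++_; concatMap; filter; length; allFin)
open import Data.List.Membership.Propositional using (_∈_)
open import Data.Nat.Base as ℕ using (ℕ; zero; suc)
open import Data.Nat.Properties using () renaming (_≤?_ to _ℕ≤?_)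
open import Data.Product.Base using (_×_; Σ-syntax; ∃-syntax)
open import Data.Vec.Base as Vec using (Vec; []; _∷_)
open import Function.Base using (_∘_)
open import Function.Definitions using (Injective)
open import Level as Level using (Level; _⊔_)
open import Relation.Binary.Bundles using (TotalOrder)
open import Relation.Binary.Core using (Rel)
open import Relation.Binary.PropositionalEquality.Core using (_≡_)
open import Relation.Binary.Structures using (IsDecTotalOrder)
open import Relation.Nullary.Decidable using (_×-dec_)
open import Relation.Nullary.Negation using (¬_)
import Algebra.Definitions.RawSemiring
import Data.List.Extrema
import Relation.Binary.Construct.NonStrictToStrict

-- The classical real numbers are the intended model.  Completeness is not
-- required: the only real number below that is not given by field operations
-- is a logarithm, and it is characterised by `IsLn`.
record OrderedField (c ℓ₁ ℓ₂ : Level) : Set (Level.suc (c ⊔ ℓ₁ ⊔ ℓ₂)) where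
  field
    commutativeRing : CommutativeRing c ℓ₁
  open CommutativeRing commutativeRing public
  infix 4 _≤_
  infix 8 _⁻¹
  infixl 7 _/_
  field
    _≤_             : Rel Carrier ℓ₂
    isDecTotalOrder : IsDecTotalOrder _≈_ _≤_
    +-monoˡ-≤       : ∀ z {x y} → x ≤ y → x + z ≤ y + z
    *-nonNeg        : ∀ {x y} → 0# ≤ x → 0# ≤ y → 0# ≤ x * y
    0≉1             : ¬ (0# ≈ 1#)
    -- The value of 0# ⁻¹ is unconstrained.
    _⁻¹             : Carrier → Carrier
    *-inverseʳ      : ∀ {x} → ¬ (x ≈ 0#) → x * x ⁻¹ ≈ 1#

  totalOrder : TotalOrder c ℓ₁ ℓ₂
  totalOrder = record { isTotalOrder = IsDecTotalOrder.isTotalOrder isDecTotalOrder }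

  open Relation.Binary.Construct.NonStrictToStrict _≈_ _≤_ public using (_<_)
  open Algebra.Definitions.RawSemiring (Semiring.rawSemiring semiring) public using (_^_) renaming (_×_ to _·_)

  _/_ : Carrier → Carrier → Carrier
  x / y = x * y ⁻¹

  fromℕ : ℕ → Carrier
  fromℕ n = n · 1#

subsets : ∀ n → List (Subset n)
subsets zero    = [] ∷ []
subsets (suc n) = List.map (outside ∷_) (subsets n) ++ List.map (inside ∷_) (subsets n)

-- Sequences of arrivals are written with the most recent arrival at the head.
-- `orders n` lists each of the n! arrival orders of n items exactly once: the
-- last arrival is any item i, preceded by any order of the remaining items.
orders : ∀ n → List (Vec (Fin n) n)
orders zero    = [] ∷ []
orders (suc n) = concatMap (λ i → List.map (λ σ → i ∷ Vec.map (punchIn i) σ) (orders n)) (allFin (suc n))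

-- The set of items that arrived at the given set of positions.
image : ∀ {n t} → Vec (Fin n) t → Subset t → Subset n
image []      []      = ⊥
image (x ∷ h) (b ∷ P) = if b then ⁅ x ⁆ ∪ image h P else image h P

module Shortlists {c ℓ₁ ℓ₂ : Level} (R : OrderedField c ℓ₁ ℓ₂) where
  open OrderedField R

  ConvergesTo : (ℕ → Carrier) → Carrier → Set (c ⊔ ℓ₁ ⊔ ℓ₂)
  ConvergesTo a y = ∀ δ → 0# < δ → ∃[ N₀ ] (∀ N → N₀ ℕ.≤ N → (- δ < a N - y) × (a N - y < δ))

  -- exp x = y, with exp x = lim (1 + x/N)^N
  IsExp : Carrier → Carrier → Set (c ⊔ ℓ₁ ⊔ ℓ₂)
  IsExp x y = ConvergesTo (λ N → (1# + x / fromℕ (suc N)) ^ suc N) y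

  -- ln y = x
  IsLn : Carrier → Carrier → Set (c ⊔ ℓ₁ ⊔ ℓ₂)
  IsLn y x = IsExp x y

  SetFunction : ℕ → Set c
  SetFunction n = Subset n → Carrier

  NonNegative : ∀ {n} → SetFunction n → Set ℓ₂
  NonNegative f = ∀ S → 0# ≤ f S

  Monotone : ∀ {n} → SetFunction n → Set ℓ₂
  Monotone f = ∀ S T → S ⊆ T → f S ≤ f T

  Submodular : ∀ {n} → SetFunction n → Set ℓ₂
  Submodular f = ∀ S T → f (S ∪ T) + f (S ∩ T) ≤ f S + f T

  -- max { f T : T ⊆ S, |T| ≤ k }; the set T = ∅ is always feasible.
  maxWithin : ∀ {n} → ℕ → SetFunction n → Subset n → Carrier
  maxWithin {n} k f S = max (f ⊥) (List.map f (filter (λ T → (T ⊆? S) ×-dec (∣ T ∣ ℕ≤? k)) (subsets n)))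
    where open Data.List.Extrema totalOrder using (max)

  _-Submodular_ : ∀ {n} → ℕ → SetFunction n → Set (c ⊔ ℓ₁ ⊔ ℓ₂)
  _-Submodular_ {n} m f = Submodular f × (Σ[ F ∈ SetFunction n ] (Submodular F × (∀ S → f S ≈ maxWithin m F S)))

  -- A ground set 𝒰 of n items drawn from the universe ℕ, and a value function
  -- on its subsets; the items are indexed by Fin n.
  record Instance (n : ℕ) : Set (c ⊔ ℓ₂) where
    field
      item           : Fin n → ℕ
      item-injective : Injective _≡_ _≡_ item
      f              : SetFunction n
      f-nonNegative  : NonNegative f
      f-monotone     : Monotone f

  -- The decision on the newest arrival is made from the items seen so far and
  -- the values of the sets of items seen so far, a set being given by the
  -- positions of its members in the sequence of arrivals.  Earlier decisions
  -- are functions of the same data, so they need not be passed separately.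
  OnlineAlgorithm : Set c
  OnlineAlgorithm = ∀ {t} → Vec ℕ (suc t) → (Subset (suc t) → Carrier) → Bool

  module _ {n : ℕ} (alg : OnlineAlgorithm) (I : Instance n) where
    open Instance I

    decisions : ∀ {t} → Vec (Fin n) t → Subset t
    decisions []      = []
    decisions (x ∷ h) = alg (Vec.map item (x ∷ h)) (f ∘ image (x ∷ h)) ∷ decisions h

    shortlist : Vec (Fin n) n → Subset n
    shortlist σ = image σ (decisions σ)

  average : List Carrier → Carrier
  average xs = List.foldr _+_ 0# xs / fromℕ (length xs)

  ALG : ∀ {n} → ℕ → OnlineAlgorithm → Instance n → Carrier
  ALG {n} k alg I = average (List.map (λ σ → maxWithin k (Instance.f I) (shortlist alg I σ)) (orders n))

  OPT : ∀ {n} → ℕ → Instance n → Carrier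
  OPT k I = maxWithin k (Instance.f I) ⊤

  ShortlistSize≤ : ∀ {n} → OnlineAlgorithm → Instance n → Carrier → Set ℓ₂
  ShortlistSize≤ {n} alg I η = ∀ σ → σ ∈ orders n → fromℕ ∣ shortlist alg I σ ∣ ≤ η

  -- ALG / OPT ≥ r, cleared of the denominator since OPT may be 0.
  RatioAtLeast : ∀ {n} → ℕ → OnlineAlgorithm → Instance n → Carrier → Set ℓ₂
  RatioAtLeast k alg I r = r * OPT k I ≤ ALG k alg I

{-# OPTIONS --safe #-}
module Submission where

open import Defs
open import Data.Bool.Base using (Bool; true; false; not; _∧_; if_then_else_)
open import Data.Bool.Properties using (if-float; T-≡; not-¬; ¬-not)
open import Data.Fin.Base using (Fin; zero; suc; punchIn; punchOut)
open import Data.Fin.Subset as Sub using (Subset; outside; ⊥; ⊤; ⁅_⁆; _∪_; _∩_; _⊆_; ∣_∣; _∈_; _∉_)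
open import Data.Fin.Subset.Properties as Subₚ using (_⊆?_; _∈?_)
open import Data.List.Base as List using (List; []; _∷_; _++_; concatMap)
open import Data.List.Relation.Unary.All as All using ()
open import Data.List.Relation.Unary.Any using (here)
open import Data.Nat.Base as ℕ using (ℕ; zero; suc; _!; _≡ᵇ_; _<ᵇ_)
open import Data.Nat.Tactic.RingSolver using (solve-∀)
open import Data.Product.Base using (_×_; _,_; proj₁; proj₂; Σ-syntax; ∃-syntax)
open import Data.Sum.Base using (_⊎_; inj₁; inj₂; [_,_]′)
open import Data.Vec.Base as Vec using (Vec; []; _∷_; lookup; tabulate; here; there)
open import Function.Base using (_∘_; id)
open import Function.Bundles using (Equivalence)
open import Function.Definitions using (Injective)
open import Level using (Level)
open import Relation.Binary.Bundles using (Poset)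
open import Relation.Binary.Definitions using (tri<; tri≈; tri>)
open import Relation.Binary.PropositionalEquality as ≡ using (_≡_; _≢_)
open import Relation.Binary.Structures using (IsDecTotalOrder)
open import Relation.Nullary using (¬_; yes; no; does; contradiction)
open import Relation.Nullary.Decidable using (dec-true; dec-false; _×-dec_)
open import Relation.Unary using (Pred; Decidable)
import Algebra.Properties.CommutativeMonoid.Sum
import Algebra.Properties.CommutativeSemigroup
import Algebra.Properties.CommutativeSemiring.Exp
import Algebra.Properties.Ring
import Algebra.Properties.Semiring.Exp
import Algebra.Properties.Semiring.Mult
import Algebra.Properties.Semiring.Sum
import Data.Fin.Properties as Finₚ
import Data.List.Extrema
import Data.List.Membership.Propositional as Listₘ
import Data.List.Membership.Propositional.Properties as Listₘₚ
import Data.List.Properties as Listₚ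
import Data.List.Relation.Unary.All.Properties as Allₚ
import Data.Nat.Properties as ℕₚ
import Data.Vec.Properties as Vecₚ
import Relation.Binary.Reasoning.PartialOrder

-- Since f is monotone and m-submodular, every set S contains a set of at most m
-- items of value f(S).  For the set P of items seen so far let T(P) ⊆ P be
-- obtained by discarding items in increasing order of their labels as long as
-- the value stays f(P); it depends on P only, and minimality gives |T(P)| ≤ m.
-- The algorithm rejects the first u ≈ nε/2 arrivals and afterwards shortlists an
-- arrival iff it belongs to T(P), until the shortlist is full.
--
-- Read time backwards: given the arrivals after time t, the t-th arrival is
-- uniform in P.  Let A be the set of later candidates.  As T(P) ∪ A has value
-- f(U), submodularity shows that adding the t-th arrival if it lies in T(P)
-- shrinks the expected gap f(U) − f(A) by a factor 1 − 1/t.  The product of these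
-- factors over t > u is u/n ≤ ε/2.
--
-- The t-th arrival is a candidate with conditional probability at most m/t, so
-- the number N of candidates satisfies E[2^N] ≤ 2 Π_{u+1<t≤n} (1 + m/t)
-- ≤ 2 (2/ε)^m.  Since 2^((2m+3) ln(2/ε)) ≥ (2/ε)^(m+2), Markov's inequality shows
-- that the shortlist overflows with probability at most ε/2.

-- Inequalities between natural numbers

module Naturals where
  open import Data.Nat.Base
  open import Data.Nat.Properties
  open ≡ using (refl; sym; trans; cong; cong₂; subst₂)

  -- A floor function with a cap. The field need not be Archimedean, so a search for the integer
  -- part of a field element may never meet a failure of `P`; the cap `n` ends it.
  greatest : ∀ {ℓ} {P : Pred ℕ ℓ} → Decidable P → P 0 → ∀ n →
             ∃[ u ] (u ≤ n × P u × (u ≡ n ⊎ ¬ P (suc u)))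
  greatest P? p₀ zero = 0 , z≤n , p₀ , inj₁ refl
  greatest P? p₀ (suc n) with greatest P? p₀ n
  ... | u , u≤n , pu , inj₂ ¬p = u , m≤n⇒m≤1+n u≤n , pu , inj₂ ¬p
  ... | u , u≤n , pu , inj₁ refl with P? (suc u)
  ...   | yes p = suc u , ≤-refl , p , inj₁ refl
  ...   | no ¬p = u , n≤1+n u , pu , inj₂ ¬p

  -- Bernoulli's inequality (1 - 1/(p+1))^j ≥ 1 - j/(p+1), multiplied by (p+1)^(j+1) and arranged
  -- without subtraction.
  bernoulli : ∀ p j → suc p ^ suc j ≤ p ^ j * suc p + j * suc p ^ j
  bernoulli p zero = ≤-reflexive (base p)
    where
    base : ∀ p → suc p * 1 ≡ 1 * suc p + 0
    base = solve-∀
  bernoulli p (suc j) = begin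
    y * y ^ suc j                              ≤⟨ *-monoʳ-≤ y (bernoulli p j) ⟩
    y * (p ^ j * y + j * y ^ j)                ≡⟨ expand p (p ^ j) (y ^ j) j ⟩
    (p * p ^ j * y + j * (y * y ^ j)) + p ^ j * y ≤⟨ +-monoʳ-≤ (p * p ^ j * y + j * (y * y ^ j)) (*-monoˡ-≤ y (^-monoˡ-≤ j (n≤1+n p))) ⟩
    (p * p ^ j * y + j * (y * y ^ j)) + y ^ j * y ≡⟨ collect p (p ^ j) (y ^ j) j ⟩
    p ^ suc j * y + suc j * y ^ suc j          ∎
    where
    open ≤-Reasoning
    y = suc p
    expand : ∀ p a b j → suc p * (a * suc p + j * b) ≡ (p * a * suc p + j * (suc p * b)) + a * suc p
    expand = solve-∀
    collect : ∀ p a b j → (p * a * suc p + j * (suc p * b)) + b * suc p ≡ p * a * suc p + suc j * (suc p * b)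
    collect = solve-∀

  -- By Bernoulli's inequality (p/(p+1))^j ≥ 1 - j/(p+1) ≥ 1 - 1/(a+1); taking reciprocals, (1 +
  -- 1/p)^j ≤ 1 + 1/a.
  growth-≤ : ∀ a p j → suc a * j ≤ suc p → a * suc p ^ j ≤ suc a * p ^ j
  growth-≤ a p j aj≤p = *-cancelˡ-≤ (suc p) (+-cancelʳ-≤ (suc p * suc p ^ j) _ _ (begin
    suc p * (a * y) + suc p * y         ≡⟨ e₁ a p y ⟩
    suc a * suc p ^ suc j               ≤⟨ *-monoʳ-≤ (suc a) (bernoulli p j) ⟩
    suc a * (p ^ j * suc p + j * y)     ≡⟨ e₂ a p j (p ^ j) y ⟩
    suc p * (suc a * p ^ j) + suc a * j * y ≤⟨ +-monoʳ-≤ (suc p * (suc a * p ^ j)) (*-monoˡ-≤ y aj≤p) ⟩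
    suc p * (suc a * p ^ j) + suc p * y ∎))
    where
    open ≤-Reasoning
    y = suc p ^ j
    e₁ : ∀ a p y → suc p * (a * y) + suc p * y ≡ suc a * (suc p * y)
    e₁ = solve-∀
    e₂ : ∀ a p j x y → suc a * (x * suc p + j * y) ≡ suc p * (suc a * x) + suc a * j * y
    e₂ = solve-∀

  -- In the form 1 + m/(t+1) ≤ ((t+1)/t)^m this replaces the factors 1 + m/i by quotients that
  -- telescope.
  pow-step : ∀ t m → t ^ m * (suc t + m) ≤ suc t ^ suc m
  pow-step t zero = ≤-reflexive (e t)
    where
    e : ∀ t → 1 * (suc t + 0) ≡ suc t * 1
    e = solve-∀
  pow-step t (suc m) = begin
    t * t ^ m * (suc t + suc m)               ≡⟨ e t m (t ^ m) ⟩
    t * (t ^ m * (suc t + m)) + t ^ m * t     ≤⟨ +-mono-≤ (*-monoʳ-≤ t (pow-step t m)) (*-mono-≤ (^-monoˡ-≤ m (n≤1+n t)) (n≤1+n t)) ⟩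
    t * suc t ^ suc m + suc t ^ m * suc t     ≡⟨ e' t (suc t ^ m) ⟩
    suc t ^ suc (suc m)                       ∎
    where
    open ≤-Reasoning
    e : ∀ t m a → t * a * (suc t + suc m) ≡ t * (a * (suc t + m)) + a * t
    e = solve-∀
    e' : ∀ t b → t * (suc t * b) + b * suc t ≡ suc t * (suc t * b)
    e' = solve-∀

  ^-distribʳ-* : ∀ n a b → (a * b) ^ n ≡ a ^ n * b ^ n
  ^-distribʳ-* zero a b = refl
  ^-distribʳ-* (suc n) a b = trans (cong (a * b *_) (^-distribʳ-* n a b)) (swap a b (a ^ n) (b ^ n))
    where
    swap : ∀ a b x y → a * b * (x * y) ≡ a * x * (b * y)
    swap = solve-∀

  growth-^-≤ : ∀ a p j k → suc a * j ≤ suc p →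
               a ^ k * suc p ^ (j * k) ≤ suc a ^ k * p ^ (j * k)
  growth-^-≤ a p j k le = subst₂ _≤_ (split a (suc p)) (split (suc a) p) (^-monoˡ-≤ k (growth-≤ a p j le))
    where
    split : ∀ b q → (b * q ^ j) ^ k ≡ b ^ k * q ^ (j * k)
    split b q = trans (^-distribʳ-* k b (q ^ j)) (cong (b ^ k *_) (^-*-assoc q j k))

  -- A single factor 125 < 128 leaves room for 100/99, since 100·125 = 12500 ≤ 12672 = 99·128; this
  -- takes an exponent of at least 1, hence `suc K`.
  100*125^Q≤99*128^Q : ∀ K → 100 * 5 ^ (3 * suc K) ≤ 99 * 4 ^ (3 * suc K) * 2 ^ suc K
  100*125^Q≤99*128^Q K = begin
    100 * 5 ^ (3 * suc K)              ≡⟨ cong (100 *_) (sym (^-*-assoc 5 3 (suc K))) ⟩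
    100 * (125 * 125 ^ K)              ≡⟨ sym (*-assoc 100 125 (125 ^ K)) ⟩
    12500 * 125 ^ K                    ≤⟨ *-mono-≤ (m≤m+n 12500 172) (^-monoˡ-≤ K (m≤m+n 125 3)) ⟩
    12672 * 128 ^ K                    ≡⟨ *-assoc 99 128 (128 ^ K) ⟩
    99 * 128 ^ suc K                   ≡⟨ cong (99 *_) (^-distribʳ-* (suc K) 64 2) ⟩
    99 * (64 ^ suc K * 2 ^ suc K)      ≡⟨ sym (*-assoc 99 (64 ^ suc K) (2 ^ suc K)) ⟩
    99 * 64 ^ suc K * 2 ^ suc K        ≡⟨ cong (λ z → 99 * z * 2 ^ suc K) (^-*-assoc 4 3 (suc K)) ⟩
    99 * 4 ^ (3 * suc K) * 2 ^ suc K   ∎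
    where open ≤-Reasoning

  -- Coefficients of the two recurrences over time

  module Recurrences (u : ℕ) where

    -- t! Π_{u<i≤t} (1 − 1/i)
    gapCoeff : ℕ → ℕ
    gapCoeff zero = 1
    gapCoeff (suc t) with u ≤? t
    ... | yes _ = t * gapCoeff t
    ... | no  _ = suc t * gapCoeff t

    gapCoeff-step : ∀ {t} → u ≤ t → gapCoeff (suc t) ≡ t * gapCoeff t
    gapCoeff-step {t} u≤t with u ≤? t
    ... | yes _   = refl
    ... | no  u≰t = contradiction u≤t u≰t

    gapCoeff-≤u : ∀ t → t ≤ u → gapCoeff t ≡ t !
    gapCoeff-≤u zero _ = refl
    gapCoeff-≤u (suc t) t<u with u ≤? t
    ... | yes u≤t = contradiction t<u (≤⇒≯ u≤t)
    ... | no  _   = cong (suc t *_) (gapCoeff-≤u t (<⇒≤ t<u))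

    -- The factors (i - 1)/i for u < i ≤ t telescope to u/t.
    gapCoeff-≥u : ∀ t → u ≤ t → t * gapCoeff t ≡ u * t !
    gapCoeff-≥u zero z≤n = refl
    gapCoeff-≥u (suc t) u≤1+t with u ≤? t
    ... | yes u≤t = trans (cong (suc t *_) (gapCoeff-≥u t u≤t)) (e u t (t !))
      where
      e : ∀ u t a → suc t * (u * a) ≡ u * (suc t * a)
      e = solve-∀
    ... | no u≰t = cong₂ _*_ (≤-antisym (≰⇒> u≰t) u≤1+t) (cong (suc t *_) (gapCoeff-≤u t (<⇒≤ (≰⇒> u≰t))))

    module _ (m : ℕ) where

      -- t! times the product over u < i ≤ t of 1 + m/i, except that the factor at
      -- i = u + 1 is 2: the others multiply to at most (n/(u+1))^m, and n/(u+1) ≤ 2/ε.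
      mgfCoeff : ℕ → ℕ
      mgfCoeff zero = 1
      mgfCoeff (suc t) with <-cmp t u
      ... | tri< _ _ _ = suc t * mgfCoeff t
      ... | tri≈ _ _ _ = 2 * suc t * mgfCoeff t
      ... | tri> _ _ _ = (suc t + m) * mgfCoeff t

      mgfCoeff-≤u : ∀ t → t ≤ u → mgfCoeff t ≡ t !
      mgfCoeff-≤u zero _ = refl
      mgfCoeff-≤u (suc t) t<u with <-cmp t u
      ... | tri< _ _ _ = cong (suc t *_) (mgfCoeff-≤u t (<⇒≤ t<u))
      ... | tri≈ _ refl _ = contradiction t<u (n≮n t)
      ... | tri> _ _ u<t = contradiction t<u (<⇒≯ u<t)

      -- Equality holds at t = u + 1, where the only factor is 2. By `pow-step` each later factor 1
      -- + m/i is at most (i/(i-1))^m, and these telescope to (t/(u+1))^m.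
      mgfCoeff->u : ∀ t → u < t → mgfCoeff t * suc u ^ m ≤ 2 * t ! * t ^ m
      mgfCoeff->u (suc t) u<1+t with <-cmp t u
      ... | tri< t<u _ _ = contradiction t<u (≤⇒≯ (≤-pred u<1+t))
      ... | tri≈ _ refl _ = ≤-reflexive (cong (_* suc t ^ m) (trans (cong (2 * suc t *_) (mgfCoeff-≤u t ≤-refl)) (*-assoc 2 (suc t) (t !))))
      ... | tri> _ _ u<t = begin
        (suc t + m) * mgfCoeff t * suc u ^ m      ≡⟨ *-assoc (suc t + m) (mgfCoeff t) (suc u ^ m) ⟩
        (suc t + m) * (mgfCoeff t * suc u ^ m)    ≤⟨ *-monoʳ-≤ (suc t + m) (mgfCoeff->u t u<t) ⟩
        (suc t + m) * (2 * t ! * t ^ m)           ≡⟨ e (suc t + m) (t !) (t ^ m) ⟩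
        2 * t ! * (t ^ m * (suc t + m))           ≤⟨ *-monoʳ-≤ (2 * t !) (pow-step t m) ⟩
        2 * t ! * (suc t * suc t ^ m)             ≡⟨ e' t (t !) (suc t ^ m) ⟩
        2 * (suc t) ! * suc t ^ m                 ∎
        where
        open ≤-Reasoning
        e : ∀ a b c → a * (2 * b * c) ≡ 2 * b * (c * a)
        e = solve-∀
        e' : ∀ t b c → 2 * b * (suc t * c) ≡ 2 * (suc t * b) * c
        e' = solve-∀

open Naturals

module ℕΣ = Algebra.Properties.CommutativeMonoid.Sum ℕₚ.+-0-commutativeMonoid

-- Arithmetic in an ordered field

module SecretaryProof {c ℓ₁ ℓ₂ : Level} (R : OrderedField c ℓ₁ ℓ₂) where
  open OrderedField R hiding (zero)
  open Shortlists R
  open Algebra.Properties.CommutativeMonoid.Sum +-commutativeMonoid using (∑-distrib-+)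
  open Algebra.Properties.CommutativeSemiring.Exp commutativeSemiring using (^-distrib-*)
  open Algebra.Properties.Ring ring using (-‿involutive; -1*x≈-x; -‿distribˡ-*)
  open Algebra.Properties.Semiring.Exp semiring using (^-congʳ; ^-assocʳ)
  open Algebra.Properties.Semiring.Mult semiring using (×1-homo-*; ×-homo-+)
  open Algebra.Properties.Semiring.Sum semiring using (sum; *-distribˡ-sum; *-distribʳ-sum; sum-cong-≋)
  module *P = Algebra.Properties.CommutativeSemigroup *-commutativeSemigroup
  module +P = Algebra.Properties.CommutativeSemigroup +-commutativeSemigroup

  open IsDecTotalOrder isDecTotalOrder using (_≤?_; total; ≤-respˡ-≈; ≤-respʳ-≈)
    renaming (refl to ≤-refl; reflexive to ≤-reflexive; trans to ≤-trans; antisym to ≤-antisym; isPartialOrder to ≤-isPartialOrder)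

  poset : Poset _ _ _
  poset = record { isPartialOrder = ≤-isPartialOrder }

  module ≤R = Relation.Binary.Reasoning.PartialOrder poset

  ≰⇒≥ : ∀ {x y} → ¬ (x ≤ y) → y ≤ x
  ≰⇒≥ {x} {y} x≰y with total x y
  ... | inj₁ x≤y = contradiction x≤y x≰y
  ... | inj₂ y≤x = y≤x

  ≰⇒> : ∀ {x y} → ¬ (x ≤ y) → y < x
  ≰⇒> x≰y = ≰⇒≥ x≰y , λ y≈x → x≰y (≤-reflexive (sym y≈x))

  +-monoʳ-≤ : ∀ z {x y} → x ≤ y → z + x ≤ z + y
  +-monoʳ-≤ z x≤y = ≤-respˡ-≈ (+-comm _ z) (≤-respʳ-≈ (+-comm _ z) (+-monoˡ-≤ z x≤y))

  +-mono-≤ : ∀ {x y u v} → x ≤ y → u ≤ v → x + u ≤ y + v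
  +-mono-≤ x≤y u≤v = ≤-trans (+-monoˡ-≤ _ x≤y) (+-monoʳ-≤ _ u≤v)

  x+z-z≈x : ∀ x z → (x + z) - z ≈ x
  x+z-z≈x x z = trans (+-assoc x z (- z)) (trans (+-congˡ (-‿inverseʳ z)) (+-identityʳ x))

  x-z+z≈x : ∀ x z → (x - z) + z ≈ x
  x-z+z≈x x z = trans (+-assoc x (- z) z) (trans (+-congˡ (-‿inverseˡ z)) (+-identityʳ x))

  +-cancelʳ-≤ : ∀ z {x y} → x + z ≤ y + z → x ≤ y
  +-cancelʳ-≤ z {x} {y} le = ≤-respˡ-≈ (x+z-z≈x x z) (≤-respʳ-≈ (x+z-z≈x y z) (+-monoˡ-≤ (- z) le))

  x≤y⇒0≤y-x : ∀ {x y} → x ≤ y → 0# ≤ y - x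
  x≤y⇒0≤y-x {x} x≤y = ≤-respˡ-≈ (-‿inverseʳ x) (+-monoˡ-≤ (- x) x≤y)

  0≤y-x⇒x≤y : ∀ {x y} → 0# ≤ y - x → x ≤ y
  0≤y-x⇒x≤y {x} {y} le = ≤-respˡ-≈ (+-identityˡ x) (≤-respʳ-≈ (x-z+z≈x y x) (+-monoˡ-≤ x le))

  x≤x+y : ∀ x {y} → 0# ≤ y → x ≤ x + y
  x≤x+y x 0≤y = ≤-respˡ-≈ (+-identityʳ x) (+-monoʳ-≤ x 0≤y)

  +-nonNeg : ∀ {x y} → 0# ≤ x → 0# ≤ y → 0# ≤ x + y
  +-nonNeg 0≤x 0≤y = ≤-trans 0≤x (x≤x+y _ 0≤y)

  *-monoˡ-≤ : ∀ z → 0# ≤ z → ∀ {x y} → x ≤ y → x * z ≤ y * z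
  *-monoˡ-≤ z 0≤z {x} {y} x≤y = 0≤y-x⇒x≤y (≤-respʳ-≈ (trans (distribʳ z y (- x)) (+-congˡ (sym (-‿distribˡ-* x z)))) (*-nonNeg (x≤y⇒0≤y-x x≤y) 0≤z))

  *-monoʳ-≤ : ∀ z → 0# ≤ z → ∀ {x y} → x ≤ y → z * x ≤ z * y
  *-monoʳ-≤ z 0≤z x≤y = ≤-respˡ-≈ (*-comm _ z) (≤-respʳ-≈ (*-comm _ z) (*-monoˡ-≤ z 0≤z x≤y))

  *-mono-≤ : ∀ {x y u v} → 0# ≤ u → 0# ≤ y → x ≤ y → u ≤ v → x * u ≤ y * v
  *-mono-≤ 0≤u 0≤y x≤y u≤v = ≤-trans (*-monoˡ-≤ _ 0≤u x≤y) (*-monoʳ-≤ _ 0≤y u≤v)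

  0≤1 : 0# ≤ 1#
  0≤1 with total 0# 1#
  ... | inj₁ 0≤1 = 0≤1
  ... | inj₂ 1≤0 = ≤-respʳ-≈ (trans (-1*x≈-x (- 1#)) (-‿involutive 1#)) (*-nonNeg 0≤-1 0≤-1)
    where
    0≤-1 : 0# ≤ - 1#
    0≤-1 = ≤-respʳ-≈ (+-identityˡ _) (x≤y⇒0≤y-x 1≤0)

  0<1 : 0# < 1#
  0<1 = 0≤1 , 0≉1

  <⇒≤ : ∀ {x y} → x < y → x ≤ y
  <⇒≤ = proj₁

  <⇒≱ : ∀ {x y} → x < y → ¬ (y ≤ x)
  <⇒≱ (x≤y , x≉y) y≤x = x≉y (≤-antisym x≤y y≤x)

  <-≤-trans : ∀ {x y z} → x < y → y ≤ z → x < z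
  <-≤-trans x<y@(x≤y , _) y≤z = ≤-trans x≤y y≤z , λ x≈z → <⇒≱ x<y (≤-respʳ-≈ (sym x≈z) y≤z)

  *-inverseʳ⁺ : ∀ {x} → 0# < x → x * x ⁻¹ ≈ 1#
  *-inverseʳ⁺ (_ , 0≉x) = *-inverseʳ (0≉x ∘ sym)

  *-cancelˡ-≤ : ∀ z → 0# < z → ∀ {x y} → z * x ≤ z * y → x ≤ y
  *-cancelˡ-≤ z 0<z {x} {y} le with total x y
  ... | inj₁ x≤y = x≤y
  ... | inj₂ y≤x = ≤-reflexive (trans (sym (undo x)) (trans (*-congˡ (≤-antisym le (*-monoʳ-≤ z (<⇒≤ 0<z) y≤x))) (undo y)))
    where
    undo : ∀ w → z ⁻¹ * (z * w) ≈ w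
    undo w = trans (sym (*-assoc _ z w)) (trans (*-congʳ (trans (*-comm _ z) (*-inverseʳ⁺ 0<z))) (*-identityˡ w))

  ⁻¹-nonNeg : ∀ {x} → 0# < x → 0# ≤ x ⁻¹
  ⁻¹-nonNeg {x} 0<x = *-cancelˡ-≤ x 0<x (≤-respˡ-≈ (sym (zeroʳ x)) (≤-respʳ-≈ (sym (*-inverseʳ⁺ 0<x)) 0≤1))

  *-pos : ∀ {x y} → 0# < x → 0# < y → 0# < x * y
  *-pos {x} {y} 0<x 0<y = *-nonNeg (<⇒≤ 0<x) (<⇒≤ 0<y) , λ 0≈xy → <⇒≱ 0<y (*-cancelˡ-≤ x 0<x (≤-reflexive (trans (sym 0≈xy) (sym (zeroʳ x)))))

  ⁻¹-pos : ∀ {x} → 0# < x → 0# < x ⁻¹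
  ⁻¹-pos {x} 0<x = ⁻¹-nonNeg 0<x , λ 0≈ → 0≉1 (trans (sym (zeroʳ x)) (trans (*-congˡ 0≈) (*-inverseʳ⁺ 0<x)))

  y*[x/y]≈x : ∀ x {y} → 0# < y → y * (x / y) ≈ x
  y*[x/y]≈x x {y} 0<y = trans (*P.x∙yz≈y∙xz y x (y ⁻¹)) (trans (*-congˡ (*-inverseʳ⁺ 0<y)) (*-identityʳ x))

  ^-nonNeg : ∀ {x} → 0# ≤ x → ∀ n → 0# ≤ x ^ n
  ^-nonNeg 0≤x zero = 0≤1
  ^-nonNeg 0≤x (suc n) = *-nonNeg 0≤x (^-nonNeg 0≤x n)

  ^-pos : ∀ {x} → 0# < x → ∀ n → 0# < x ^ n
  ^-pos 0<x zero = 0<1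
  ^-pos 0<x (suc n) = *-pos 0<x (^-pos 0<x n)

  ^-monoˡ-≤ : ∀ n {x y} → 0# ≤ x → x ≤ y → x ^ n ≤ y ^ n
  ^-monoˡ-≤ zero _ _ = ≤-refl
  ^-monoˡ-≤ (suc n) 0≤x x≤y = *-mono-≤ (^-nonNeg 0≤x n) (≤-trans 0≤x x≤y) x≤y (^-monoˡ-≤ n 0≤x x≤y)

  ^-≤1 : ∀ n {x} → 0# ≤ x → x ≤ 1# → x ^ n ≤ 1#
  ^-≤1 zero _ _ = ≤-refl
  ^-≤1 (suc n) 0≤x x≤1 = ≤-respʳ-≈ (*-identityˡ 1#) (*-mono-≤ (^-nonNeg 0≤x n) 0≤1 x≤1 (^-≤1 n 0≤x x≤1))

  fromℕ-nonNeg : ∀ n → 0# ≤ fromℕ n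
  fromℕ-nonNeg zero = ≤-refl
  fromℕ-nonNeg (suc n) = +-nonNeg 0≤1 (fromℕ-nonNeg n)

  fromℕ-pos : ∀ {n} → 0 ℕ.< n → 0# < fromℕ n
  fromℕ-pos {suc n} _ = <-≤-trans 0<1 (x≤x+y 1# (fromℕ-nonNeg n))

  fromℕ-mono : ∀ {a b} → a ℕ.≤ b → fromℕ a ≤ fromℕ b
  fromℕ-mono {b = b} ℕ.z≤n = fromℕ-nonNeg b
  fromℕ-mono (ℕ.s≤s a≤b) = +-monoʳ-≤ 1# (fromℕ-mono a≤b)

  fromℕ-+ : ∀ a b → fromℕ (a ℕ.+ b) ≈ fromℕ a + fromℕ b
  fromℕ-+ = ×-homo-+ 1#

  fromℕ-* : ∀ a b → fromℕ (a ℕ.* b) ≈ fromℕ a * fromℕ b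
  fromℕ-* = ×1-homo-*

  fromℕ-1 : fromℕ 1 ≈ 1#
  fromℕ-1 = +-identityʳ 1#

  fromℕ-^ : ∀ a n → fromℕ (a ℕ.^ n) ≈ fromℕ a ^ n
  fromℕ-^ a zero = fromℕ-1
  fromℕ-^ a (suc n) = trans (fromℕ-* a (a ℕ.^ n)) (*-congˡ (fromℕ-^ a n))

  fromℕ-*-mono : ∀ {a b a′ b′ : ℕ} → a ℕ.* b ℕ.≤ a′ ℕ.* b′ → fromℕ a * fromℕ b ≤ fromℕ a′ * fromℕ b′
  fromℕ-*-mono {a} {b} {a′} {b′} le = ≤-respˡ-≈ (fromℕ-* a b) (≤-respʳ-≈ (fromℕ-* a′ b′) (fromℕ-mono le))

  -δ<x-y⇒y≤x+δ : ∀ {δ x y} → - δ < x - y → y ≤ x + δ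
  -δ<x-y⇒y≤x+δ {δ} {x} {y} (le , _) = begin
    y                   ≈⟨ +-identityˡ y ⟨
    0# + y              ≈⟨ +-congʳ (-‿inverseˡ δ) ⟨
    (- δ + δ) + y       ≈⟨ +-assoc _ _ _ ⟩
    - δ + (δ + y)       ≤⟨ +-monoˡ-≤ (δ + y) le ⟩
    (x - y) + (δ + y)   ≈⟨ +P.x∙yz≈xz∙y (x - y) δ y ⟩
    ((x - y) + y) + δ   ≈⟨ +-congʳ (x-z+z≈x x y) ⟩
    x + δ               ∎
    where open ≤R

  -- Powers and the logarithm

  square-nonNeg : ∀ x → 0# ≤ x * x
  square-nonNeg x with total 0# x
  ... | inj₁ 0≤x = *-nonNeg 0≤x 0≤x
  ... | inj₂ x≤0 = ≤-respʳ-≈ (trans (sym (-‿distribˡ-* x (- x))) (trans (-‿cong (trans (*-comm x (- x)) (sym (-‿distribˡ-* x x)))) (-‿involutive (x * x)))) (*-nonNeg 0≤-x 0≤-x)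
    where
    0≤-x : 0# ≤ - x
    0≤-x = ≤-respʳ-≈ (+-identityˡ _) (x≤y⇒0≤y-x x≤0)

  -- For x ≤ 0 the odd power is `x` times a power of a square, hence at most 0.
  odd-^-≤1 : ∀ k {x} → x ≤ 1# → x ^ suc (2 ℕ.* k) ≤ 1#
  odd-^-≤1 k {x} x≤1 with total 0# x
  ... | inj₁ 0≤x = ^-≤1 (suc (2 ℕ.* k)) 0≤x x≤1
  ... | inj₂ x≤0 = ≤-trans (≤-respʳ-≈ (zeroˡ _) (*-monoˡ-≤ _ even-nonNeg x≤0)) 0≤1
    where
    even-nonNeg : 0# ≤ x ^ (2 ℕ.* k)
    even-nonNeg = ≤-respʳ-≈ (^-assocʳ x 2 k) (^-nonNeg (≤-respʳ-≈ (*-congˡ (sym (*-identityʳ x))) (square-nonNeg x)) k)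

  -- The field need not be Archimedean, so 1 + L/N may stay negative for L < 0; odd
  -- exponents cover this case as well.
  ln-nonNeg : ∀ {r L} → fromℕ 2 < r → IsLn r L → 0# ≤ L
  ln-nonNeg {r} {L} 2<r lnL with total 0# L
  ... | inj₁ 0≤L = 0≤L
  -- If L ≤ 0, then (1 + L/N)^N ≤ 1 for every odd N, while for large N it is within 1 of `r`; this
  -- would give r ≤ 2.
  ... | inj₂ L≤0 with lnL 1# 0<1
  ...   | N₀ , close = contradiction (begin
          r              ≤⟨ -δ<x-y⇒y≤x+δ (proj₁ (close (2 ℕ.* N₀) (ℕₚ.m≤m+n N₀ _))) ⟩
          b ^ k + 1#     ≤⟨ +-monoˡ-≤ 1# (odd-^-≤1 N₀ b≤1) ⟩
          1# + 1#        ≈⟨ +-congˡ fromℕ-1 ⟨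
          fromℕ 2        ∎) (<⇒≱ 2<r)
    where
    open ≤R
    k = suc (2 ℕ.* N₀)
    b = 1# + L / fromℕ k
    b≤1 : b ≤ 1#
    b≤1 = begin
      1# + L / fromℕ k          ≤⟨ +-monoʳ-≤ 1# (*-monoˡ-≤ _ (⁻¹-nonNeg (fromℕ-pos {k} (ℕ.s≤s ℕ.z≤n))) L≤0) ⟩
      1# + 0# * fromℕ k ⁻¹      ≈⟨ +-congˡ (zeroˡ _) ⟩
      1# + 0#                   ≈⟨ +-identityʳ 1# ⟩
      1#                        ∎

  -- (1 + L/N)^N is compared with 2 at N = 3QM, Q = K + 1: there 1 + L/N ≤ 1 + 1/(3sM), and
  -- (1 + 1/(3sM))^(dM) ≤ 5/4 because 5d ≤ 3s, while (5/4)³ < 2.  The slack between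
  -- (5/4)³ and 2 absorbs the distance of (1 + L/N)^N from its limit.
  exp-^-≤-2^ : ∀ {r L} d s K → 0# < r → IsLn r L → 0# ≤ L → 0 ℕ.< d → 0 ℕ.< s → 5 ℕ.* d ℕ.≤ 3 ℕ.* s →
               fromℕ s * L ≤ fromℕ (suc K) → r ^ d ≤ fromℕ (2 ℕ.^ suc K)
  exp-^-≤-2^ {r} {L} d s K 0<r lnL 0≤L 0<d 0<s 5d≤3s sL≤Q =
    *-cancelˡ-≤ (fromℕ (99 ℕ.* 4 ℕ.^ (3 ℕ.* Q))) (fromℕ-pos (ℕₚ.*-mono-≤ (ℕ.s≤s (ℕ.z≤n {98})) (ℕₚ.m^n>0 4 (3 ℕ.* Q)))) (begin
      fromℕ (99 ℕ.* F) * r ^ d                ≈⟨ trans (*-congʳ (fromℕ-* 99 F)) (*P.xy∙z≈y∙xz _ _ _) ⟩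
      fromℕ F * (fromℕ 99 * r ^ d)            ≤⟨ *-monoʳ-≤ _ (fromℕ-nonNeg F) 99r^d≤100a^E ⟩
      fromℕ F * (fromℕ 100 * a ^ E)           ≈⟨ *P.x∙yz≈y∙xz _ _ _ ⟩
      fromℕ 100 * (fromℕ F * a ^ E)           ≤⟨ *-monoʳ-≤ _ (fromℕ-nonNeg 100) Fa^E≤G ⟩
      fromℕ 100 * fromℕ G                     ≤⟨ fromℕ-*-mono {100} {G} {99 ℕ.* F} {2 ℕ.^ Q} (100*125^Q≤99*128^Q K) ⟩
      fromℕ (99 ℕ.* F) * fromℕ (2 ℕ.^ Q)      ∎)
    where
    open ≤R
    Q = suc K
    F = 4 ℕ.^ (3 ℕ.* Q)
    G = 5 ℕ.^ (3 ℕ.* Q)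
    -- The factor 100 gives (1 + 1/x)^d ≤ 100/99 by `growth-≤`. The choice of `δ` turns r ≤ a^N′ + δ
    -- into x r ≤ (x+1) a^N′.
    x = 100 ℕ.* d
    y = suc x
    δ = r / fromℕ y
    0<y : 0# < fromℕ y
    0<y = fromℕ-pos {y} (ℕ.s≤s ℕ.z≤n)
    near = lnL δ (*-pos 0<r (⁻¹-pos 0<y))
    -- As `M` is a successor, `N′` unfolds to the successor of `proj₁ near` plus some number, so the
    -- convergence bound applies to the exponent `N′`.
    M = suc (proj₁ near)
    N′ = 3 ℕ.* Q ℕ.* M
    p = 3 ℕ.* s ℕ.* M
    j = d ℕ.* M
    E = j ℕ.* (3 ℕ.* Q)
    a = 1# + L / fromℕ N′
    0<N′ : 0# < fromℕ N′
    0<N′ = fromℕ-pos {N′} (ℕ.s≤s ℕ.z≤n)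
    0<p : 0 ℕ.< p
    0<p = ℕₚ.*-mono-≤ (ℕₚ.*-mono-≤ (ℕ.s≤s (ℕ.z≤n {2})) 0<s) (ℕ.s≤s (ℕ.z≤n {proj₁ near}))
    0<x : 0 ℕ.< x
    0<x = ℕₚ.*-mono-≤ (ℕ.s≤s (ℕ.z≤n {99})) 0<d
    0≤a : 0# ≤ a
    0≤a = +-nonNeg 0≤1 (*-nonNeg 0≤L (⁻¹-nonNeg 0<N′))

    pa≤1+p : fromℕ p * a ≤ fromℕ (suc p)
    pa≤1+p = begin
      fromℕ p * a                                ≈⟨ distribˡ _ _ _ ⟩
      fromℕ p * 1# + fromℕ p * (L / fromℕ N′)    ≈⟨ +-cong (*-identityʳ _) (sym (*-assoc _ _ _)) ⟩
      fromℕ p + fromℕ p * L * fromℕ N′ ⁻¹        ≤⟨ +-monoʳ-≤ _ (*-monoˡ-≤ _ (⁻¹-nonNeg 0<N′) pL≤N′) ⟩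
      fromℕ p + fromℕ N′ * fromℕ N′ ⁻¹           ≈⟨ +-congˡ (*-inverseʳ⁺ 0<N′) ⟩
      fromℕ p + 1#                               ≈⟨ +-comm _ _ ⟩
      fromℕ (suc p)                              ∎
      where
      pL≤N′ : fromℕ p * L ≤ fromℕ N′
      pL≤N′ = begin
        fromℕ p * L                    ≈⟨ *-congʳ (reflexive (≡.cong fromℕ (e s M))) ⟩
        fromℕ (3 ℕ.* M ℕ.* s) * L      ≈⟨ trans (*-congʳ (fromℕ-* (3 ℕ.* M) s)) (*-assoc _ _ _) ⟩
        fromℕ (3 ℕ.* M) * (fromℕ s * L) ≤⟨ *-monoʳ-≤ _ (fromℕ-nonNeg (3 ℕ.* M)) sL≤Q ⟩
        fromℕ (3 ℕ.* M) * fromℕ Q      ≈⟨ fromℕ-* (3 ℕ.* M) Q ⟨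
        fromℕ (3 ℕ.* M ℕ.* Q)          ≈⟨ reflexive (≡.cong fromℕ (≡.sym (e Q M))) ⟩
        fromℕ N′                       ∎
        where
        e : ∀ s M → 3 ℕ.* s ℕ.* M ≡ 3 ℕ.* M ℕ.* s
        e = solve-∀

    5j≤1+p : 5 ℕ.* j ℕ.≤ suc p
    5j≤1+p = ℕₚ.≤-trans (ℕₚ.≤-reflexive (≡.sym (ℕₚ.*-assoc 5 d M))) (ℕₚ.≤-trans (ℕₚ.*-monoˡ-≤ M 5d≤3s) (ℕₚ.n≤1+n p))

    Fa^E≤G : fromℕ F * a ^ E ≤ fromℕ G
    Fa^E≤G = *-cancelˡ-≤ (fromℕ p ^ E) (^-pos (fromℕ-pos 0<p) E) (begin
      fromℕ p ^ E * (fromℕ F * a ^ E)          ≈⟨ *P.x∙yz≈y∙xz _ _ _ ⟩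
      fromℕ F * (fromℕ p ^ E * a ^ E)          ≈⟨ *-congˡ (^-distrib-* (fromℕ p) a E) ⟨
      fromℕ F * (fromℕ p * a) ^ E              ≤⟨ *-monoʳ-≤ _ (fromℕ-nonNeg F) (^-monoˡ-≤ E (*-nonNeg (fromℕ-nonNeg p) 0≤a) pa≤1+p) ⟩
      fromℕ F * fromℕ (suc p) ^ E              ≈⟨ *-congˡ (fromℕ-^ (suc p) E) ⟨
      fromℕ F * fromℕ (suc p ℕ.^ E)            ≤⟨ fromℕ-*-mono {F} {suc p ℕ.^ E} {G} {p ℕ.^ E} (growth-^-≤ 4 p j (3 ℕ.* Q) 5j≤1+p) ⟩
      fromℕ G * fromℕ (p ℕ.^ E)                ≈⟨ trans (*-comm _ _) (*-congʳ (fromℕ-^ p E)) ⟩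
      fromℕ p ^ E * fromℕ G                    ∎)

    xr≤ya : fromℕ x * r ≤ fromℕ y * a ^ N′
    xr≤ya = +-cancelʳ-≤ r (begin
      fromℕ x * r + r                    ≈⟨ trans (+-comm _ _) (+-congʳ (sym (*-identityˡ r))) ⟩
      1# * r + fromℕ x * r               ≈⟨ distribʳ r _ _ ⟨
      fromℕ y * r                        ≤⟨ *-monoʳ-≤ _ (<⇒≤ 0<y) (-δ<x-y⇒y≤x+δ (proj₁ (proj₂ near _ (ℕₚ.m≤m+n (proj₁ near) _)))) ⟩
      fromℕ y * (a ^ N′ + δ)             ≈⟨ distribˡ _ _ _ ⟩
      fromℕ y * a ^ N′ + fromℕ y * δ     ≈⟨ +-congˡ (y*[x/y]≈x r 0<y) ⟩
      fromℕ y * a ^ N′ + r               ∎)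

    N′d≡E : N′ ℕ.* d ≡ E
    N′d≡E = e Q M d
      where
      e : ∀ Q M d → 3 ℕ.* Q ℕ.* M ℕ.* d ≡ d ℕ.* M ℕ.* (3 ℕ.* Q)
      e = solve-∀

    99r^d≤100a^E : fromℕ 99 * r ^ d ≤ fromℕ 100 * a ^ E
    99r^d≤100a^E = *-cancelˡ-≤ (fromℕ x ^ d) (^-pos (fromℕ-pos 0<x) d) (begin
      fromℕ x ^ d * (fromℕ 99 * r ^ d)          ≈⟨ *P.x∙yz≈y∙xz _ _ _ ⟩
      fromℕ 99 * (fromℕ x ^ d * r ^ d)          ≈⟨ *-congˡ (^-distrib-* (fromℕ x) r d) ⟨
      fromℕ 99 * (fromℕ x * r) ^ d              ≤⟨ *-monoʳ-≤ _ (fromℕ-nonNeg 99) (^-monoˡ-≤ d (*-nonNeg (fromℕ-nonNeg x) (<⇒≤ 0<r)) xr≤ya) ⟩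
      fromℕ 99 * (fromℕ y * a ^ N′) ^ d         ≈⟨ *-congˡ (trans (^-distrib-* (fromℕ y) (a ^ N′) d) (*-cong (sym (fromℕ-^ y d)) (trans (^-assocʳ a N′ d) (^-congʳ a N′d≡E)))) ⟩
      fromℕ 99 * (fromℕ (y ℕ.^ d) * a ^ E)      ≈⟨ *-assoc _ _ _ ⟨
      fromℕ 99 * fromℕ (y ℕ.^ d) * a ^ E        ≤⟨ *-monoˡ-≤ _ (^-nonNeg 0≤a E) (fromℕ-*-mono {99} {y ℕ.^ d} {100} {x ℕ.^ d} (growth-≤ 99 x d (ℕₚ.n≤1+n x))) ⟩
      fromℕ 100 * fromℕ (x ℕ.^ d) * a ^ E       ≈⟨ trans (*-congʳ (*-congˡ (fromℕ-^ x d))) (*P.xy∙z≈y∙xz _ _ _) ⟩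
      fromℕ x ^ d * (fromℕ 100 * a ^ E)         ∎)

  -- Pruning the set of items seen so far

  without : ∀ {t} → ℕ → Vec ℕ t → Subset t → Subset t
  without v = Vec.zipWith (λ i b → b ∧ not (i ≡ᵇ v))

  -- The loop runs over labels and not over positions, so that the items kept depend on the set of
  -- items seen and not on their order of arrival.
  prune : ∀ {t} → Vec ℕ t → (Subset t → Carrier) → ℕ → Subset t
  prune ids o zero    = ⊤
  prune ids o (suc v) = if does (o ⊤ ≤? o rest) then rest else prune ids o v
    where rest = without v ids (prune ids o v)

  x∈p─q⇒x∉q : ∀ {n} {x : Fin n} (p q : Subset n) → x ∈ p Sub.─ q → x ∉ q
  x∈p─q⇒x∉q (true  ∷ p) (false ∷ q) here        ()
  x∈p─q⇒x∉q (true  ∷ p) (false ∷ q) (there x∈p) (there x∈q) = x∈p─q⇒x∉q p q x∈p x∈q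
  x∈p─q⇒x∉q (false ∷ p) (false ∷ q) (there x∈p) (there x∈q) = x∈p─q⇒x∉q p q x∈p x∈q
  x∈p─q⇒x∉q (_     ∷ p) (true  ∷ q) (there x∈p) (there x∈q) = x∈p─q⇒x∉q p q x∈p x∈q

  x∈p-y⁻ : ∀ {n} {x y : Fin n} {p} → x ∈ p Sub.- y → x ∈ p × x ≢ y
  x∈p-y⁻ {y = y} {p} x∈ = Subₚ.p─q⊆p p ⁅ y ⁆ x∈ , Subₚ.x∉⁅y⁆⇒x≢y (x∈p─q⇒x∉q p ⁅ y ⁆ x∈)

  ∈-image⁻ : ∀ {n t} {x : Fin n} (h : Vec (Fin n) t) S → x ∈ image h S → ∃[ j ] lookup h j ≡ x
  ∈-image⁻ [] [] x∈ = contradiction x∈ Subₚ.∉⊥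
  ∈-image⁻ (y ∷ h) (true ∷ S) x∈ with Subₚ.x∈p∪q⁻ ⁅ y ⁆ (image h S) x∈
  ... | inj₁ x∈y = zero , ≡.sym (Subₚ.x∈⁅y⁆⇒x≡y y x∈y)
  ... | inj₂ x∈h with ∈-image⁻ h S x∈h
  ...   | j , eq = suc j , eq
  ∈-image⁻ (y ∷ h) (false ∷ S) x∈ with ∈-image⁻ h S x∈
  ... | j , eq = suc j , eq

  ∉⇒lookup≡false : ∀ {n} {x : Fin n} {S : Subset n} → x ∉ S → lookup S x ≡ false
  ∉⇒lookup≡false {x = x} {S} x∉S = ¬-not (λ eq → x∉S (Vecₚ.lookup⇒[]= x S eq))

  -- An item that also occurred earlier could enter the image through another position. For a new
  -- item, the entry at the newest position is a question about a set of items alone.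
  lookup-image-head : ∀ {n t} (x : Fin n) (h : Vec (Fin n) t) → (∀ j → lookup h j ≢ x) →
                      ∀ S → lookup (image (x ∷ h) S) x ≡ Vec.head S
  lookup-image-head x h new (true ∷ S) = Vecₚ.[]=⇒lookup (Subₚ.x∈p∪q⁺ (inj₁ (Subₚ.x∈⁅x⁆ x)))
  lookup-image-head x h new (false ∷ S) = ∉⇒lookup≡false λ x∈ → let j , eq = ∈-image⁻ h S x∈ in new j eq

  module Pruning {n : ℕ} (item : Fin n → ℕ) (item-injective : Injective _≡_ _≡_ item)
                 (f : SetFunction n) (f-monotone : Monotone f) where

    avoiding : ℕ → Subset n
    avoiding v = tabulate (λ x → not (item x ≡ᵇ v))

    ∈-avoiding⁺ : ∀ {x v} → item x ≢ v → x ∈ avoiding v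
    ∈-avoiding⁺ {x} {v} ne = Vecₚ.lookup⇒[]= x _ (≡.trans (Vecₚ.lookup∘tabulate _ x) (≡.cong not (¬-not λ eq → ne (ℕₚ.≡ᵇ⇒≡ _ _ (Equivalence.from T-≡ eq)))))

    ∈-avoiding⁻ : ∀ {x v} → x ∈ avoiding v → item x ≢ v
    ∈-avoiding⁻ {x} {v} x∈ eq = not-¬ (≡.trans (≡.sym (Vecₚ.lookup∘tabulate _ x)) (Vecₚ.[]=⇒lookup x∈)) (≡.cong not (Equivalence.to T-≡ (ℕₚ.≡⇒≡ᵇ (item x) v eq)))

    -- The counterpart of `prune` on sets of items; by `image-prune` the two agree, which frees the
    -- pruned set from the order of arrival.
    pruned : Subset n → ℕ → Subset n
    pruned P zero    = P
    pruned P (suc v) = if does (f P ≤? f rest) then rest else pruned P v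
      where rest = pruned P v ∩ avoiding v

    image-without : ∀ {t} v (h : Vec (Fin n) t) S → image h (without v (Vec.map item h) S) ≡ image h S ∩ avoiding v
    image-without v [] [] = ≡.sym (Subₚ.∩-zeroˡ _)
    image-without v (x ∷ h) (false ∷ S) = image-without v h S
    image-without v (x ∷ h) (true ∷ S) with item x ≡ᵇ v in eq
    ... | true = ≡.trans (image-without v h S) (≡.sym (≡.trans (Subₚ.∩-distribʳ-∪ _ _ _) (≡.trans (≡.cong (_∪ _) disjoint) (Subₚ.∪-identityˡ _))))
      where
      disjoint : ⁅ x ⁆ ∩ avoiding v ≡ ⊥
      disjoint = Subₚ.⊆-antisym (λ y∈ → let y∈x , y∈a = Subₚ.x∈p∩q⁻ ⁅ x ⁆ (avoiding v) y∈ in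
        contradiction (≡.trans (≡.cong item (Subₚ.x∈⁅y⁆⇒x≡y x y∈x)) (ℕₚ.≡ᵇ⇒≡ _ _ (Equivalence.from T-≡ eq))) (∈-avoiding⁻ y∈a)) (Subₚ.⊆-min _)
    ... | false = ≡.trans (≡.cong₂ _∪_ (≡.sym included) (image-without v h S)) (≡.sym (Subₚ.∩-distribʳ-∪ _ _ _))
      where
      x∈a : x ∈ avoiding v
      x∈a = ∈-avoiding⁺ λ e → contradiction (≡.trans (≡.sym eq) (Equivalence.to T-≡ (ℕₚ.≡⇒≡ᵇ (item x) v e))) λ ()
      included : ⁅ x ⁆ ∩ avoiding v ≡ ⁅ x ⁆
      included = Subₚ.⊆-antisym (Subₚ.p∩q⊆p _ _) (λ y∈ → Subₚ.x∈p∩q⁺ (y∈ , ≡.subst (_∈ avoiding v) (≡.sym (Subₚ.x∈⁅y⁆⇒x≡y x y∈)) x∈a))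

    image-prune : ∀ {t} (h : Vec (Fin n) t) v → image h (prune (Vec.map item h) (f ∘ image h) v) ≡ pruned (image h ⊤) v
    image-prune h zero = ≡.refl
    image-prune h (suc v) = ≡.trans (if-float (image h) (does (f (image h ⊤) ≤? f (image h rest))))
        (≡.cong₂ (λ A B → if does (f (image h ⊤) ≤? f A) then A else B) same (image-prune h v))
      where
      rest = without v (Vec.map item h) (prune (Vec.map item h) (f ∘ image h) v)
      same : image h rest ≡ pruned (image h ⊤) v ∩ avoiding v
      same = ≡.trans (image-without v h _) (≡.cong (_∩ avoiding v) (image-prune h v))

    pruned-⊆ : ∀ P v → pruned P v ⊆ P
    pruned-⊆ P zero = Subₚ.⊆-refl
    pruned-⊆ P (suc v) with f P ≤? f (pruned P v ∩ avoiding v)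
    ... | yes _ = Subₚ.⊆-trans (Subₚ.p∩q⊆p _ _) (pruned-⊆ P v)
    ... | no  _ = pruned-⊆ P v

    f-pruned : ∀ P v → f P ≤ f (pruned P v)
    f-pruned P zero = ≤-refl
    f-pruned P (suc v) with f P ≤? f (pruned P v ∩ avoiding v)
    ... | yes le = le
    ... | no  _  = f-pruned P v

    -- When the label of `x` was tried, dropping `x` lost value. The set has only shrunk since then,
    -- so by monotonicity dropping `x` still loses value.
    pruned-essential : ∀ P v {x} → x ∈ pruned P v → item x ℕ.< v → ¬ (f P ≤ f (pruned P v Sub.- x))
    pruned-essential P (suc v) {x} x∈ x<1+v le with f P ≤? f (pruned P v ∩ avoiding v)
    ... | yes _ = pruned-essential P v x∈W (ℕₚ.≤∧≢⇒< (ℕₚ.≤-pred x<1+v) (∈-avoiding⁻ (proj₂ x∈′)))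
                    (≤-trans le (f-monotone _ _ λ y∈ → let y∈T , y≢x = x∈p-y⁻ y∈ in
                      Subₚ.x∈p∧x≢y⇒x∈p-y (Subₚ.p∩q⊆p _ _ y∈T) y≢x))
      where
      x∈′ = Subₚ.x∈p∩q⁻ (pruned P v) (avoiding v) x∈
      x∈W = proj₁ x∈′
    ... | no fails with item x ℕₚ.≟ v
    ...   | yes eq = fails (≤-trans le (f-monotone _ _ λ y∈ → let y∈W , y≢x = x∈p-y⁻ y∈ in
                       Subₚ.x∈p∩q⁺ (y∈W , ∈-avoiding⁺ λ e → y≢x (item-injective (≡.trans e (≡.sym eq))))))
    ...   | no  ne = pruned-essential P v x∈ (ℕₚ.≤∧≢⇒< (ℕₚ.≤-pred x<1+v) ne) le

    -- Let W be the pruned set and `T` a subset of W of at most `m` items with the value of W. An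
    -- item of W outside `T` could be dropped without loss, against `pruned-essential`; so W is
    -- contained in `T`.
    pruned-small : ∀ {m} → (∀ S → ∃[ T ] (T ⊆ S × ∣ T ∣ ℕ.≤ m × f S ≤ f T)) →
                   ∀ P v → (∀ {x} → x ∈ P → item x ℕ.< v) → ∣ pruned P v ∣ ℕ.≤ m
    pruned-small basis P v bound with basis (pruned P v)
    ... | T , T⊆W , ∣T∣≤m , fW≤fT = ℕₚ.≤-trans (Subₚ.p⊆q⇒∣p∣≤∣q∣ W⊆T) ∣T∣≤m
      where
      W⊆T : pruned P v ⊆ T
      W⊆T {x} x∈W with x ∈? T
      ... | yes x∈T = x∈T
      ... | no  x∉T = contradiction (≤-trans (f-pruned P v) (≤-trans fW≤fT (f-monotone _ _ λ y∈T →
              Subₚ.x∈p∧x≢y⇒x∈p-y (T⊆W y∈T) λ y≡x → x∉T (≡.subst (_∈ T) y≡x y∈T))))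
              (pruned-essential P v x∈W (bound (pruned-⊆ P v x∈W)))

  -- Orders of a family of items

  data Enumerates {n : ℕ} : ∀ {t} → (Fin t → Fin n) → Vec (Fin n) t → Set where
    []  : ∀ {e} → Enumerates e []
    _∷_ : ∀ {t e} {h : Vec (Fin n) t} i → Enumerates (e ∘ punchIn i) h → Enumerates e (e i ∷ h)

  tabulate-enumerates : ∀ {n t} (e : Fin t → Fin n) → Enumerates e (tabulate e)
  tabulate-enumerates {t = zero}  e = []
  tabulate-enumerates {t = suc t} e = zero ∷ tabulate-enumerates (e ∘ suc)

  enumerates-lookup : ∀ {n t} {e : Fin t → Fin n} {h} → Enumerates e h → ∀ j → ∃[ i ] lookup h j ≡ e i
  enumerates-lookup (i ∷ en) zero = i , ≡.refl
  enumerates-lookup (i ∷ en) (suc j) = let k , eq = enumerates-lookup en j in punchIn i k , eq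

  enumerates-∈ : ∀ {n t} {e : Fin t → Fin n} {h} → Enumerates e h → ∀ i → e i ∈ image h ⊤
  enumerates-∈ {e = e} (k ∷ en) i with k Finₚ.≟ i
  ... | yes ≡.refl = Subₚ.x∈p∪q⁺ (inj₁ (Subₚ.x∈⁅x⁆ _))
  ... | no  k≢i    = Subₚ.x∈p∪q⁺ (inj₂ (≡.subst (λ i → e i ∈ _) (Finₚ.punchIn-punchOut k≢i) (enumerates-∈ en (punchOut k≢i))))

  range : ∀ {n t} → (Fin t → Fin n) → Subset n
  range e = image (tabulate e) ⊤

  ∈-range⁺ : ∀ {n t} (e : Fin t → Fin n) i → e i ∈ range e
  ∈-range⁺ e = enumerates-∈ (tabulate-enumerates e)

  ∈-range⁻ : ∀ {n t} (e : Fin t → Fin n) {x} → x ∈ range e → ∃[ i ] e i ≡ x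
  ∈-range⁻ e x∈ = let j , eq = ∈-image⁻ (tabulate e) ⊤ x∈ in j , ≡.trans (≡.sym (Vecₚ.lookup∘tabulate e j)) eq

  range-punchIn : ∀ {n t} (e : Fin (suc t) → Fin n) i {x} → x ∈ range e → x ≡ e i ⊎ x ∈ range (e ∘ punchIn i)
  range-punchIn e i x∈ with ∈-range⁻ e x∈
  ... | k , ≡.refl with i Finₚ.≟ k
  ...   | yes ≡.refl = inj₁ ≡.refl
  ...   | no  i≢k    = inj₂ (≡.subst (λ k → e k ∈ _) (Finₚ.punchIn-punchOut i≢k) (∈-range⁺ (e ∘ punchIn i) (punchOut i≢k)))

  -- Whatever depends on the set of items seen is therefore constant over all orders of `e`.
  enumerates-image : ∀ {n t} {e : Fin t → Fin n} {h} → Enumerates e h → image h ⊤ ≡ range e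
  enumerates-image {e = e} {h} en = Subₚ.⊆-antisym
    (λ x∈ → let j , eq = ∈-image⁻ h ⊤ x∈ ; i , eq′ = enumerates-lookup en j in
      ≡.subst (_∈ range e) (≡.trans (≡.sym eq′) eq) (∈-range⁺ e i))
    (λ x∈ → let i , eq = ∈-range⁻ e x∈ in ≡.subst (_∈ image h ⊤) eq (enumerates-∈ en i))

  enumerates-sum : ∀ {n t} (g : Fin n → ℕ) {e : Fin t → Fin n} {h} → Enumerates e h →
                   Vec.sum (Vec.map g h) ≡ ℕΣ.sum (g ∘ e)
  enumerates-sum g [] = ≡.refl
  enumerates-sum g {e} (i ∷ en) = ≡.trans (≡.cong (g (e i) ℕ.+_) (enumerates-sum g en)) (≡.sym (ℕΣ.sum-remove {i = i} (g ∘ e)))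

  -- Sums over arrival orders

  sum-mono-≤ : ∀ {t} {f g : Fin t → Carrier} → (∀ i → f i ≤ g i) → sum f ≤ sum g
  sum-mono-≤ {zero}  f≤g = ≤-refl
  sum-mono-≤ {suc t} f≤g = +-mono-≤ (f≤g zero) (sum-mono-≤ (f≤g ∘ suc))

  fromℕ-sum : ∀ {t} (w : Fin t → ℕ) → fromℕ (ℕΣ.sum w) ≈ sum (fromℕ ∘ w)
  fromℕ-sum {zero}  w = refl
  fromℕ-sum {suc t} w = trans (fromℕ-+ (w zero) _) (+-congˡ (fromℕ-sum (w ∘ suc)))

  sum-const : ∀ t a → sum {t} (λ _ → a) ≈ fromℕ t * a
  sum-const zero    a = sym (zeroˡ a)
  sum-const (suc t) a = trans (+-cong (sym (*-identityˡ a)) (sum-const t a)) (sym (distribʳ a 1# (fromℕ t)))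

  -- The head is the last arrival, so the recursion runs backwards in time: the outer sum chooses
  -- the last arrival among the items of `e`, and `e ∘ punchIn i` is the family of the remaining
  -- ones.
  ∑ : ∀ {n t} → (Fin t → Fin n) → (Vec (Fin n) t → Carrier) → Carrier
  ∑ {t = zero}  e Φ = Φ []
  ∑ {t = suc t} e Φ = sum (λ i → ∑ (e ∘ punchIn i) (λ h → Φ (e i ∷ h)))

  ∑-mono-≤ : ∀ {n t} (e : Fin t → Fin n) {Φ Ψ} → (∀ {h} → Enumerates e h → Φ h ≤ Ψ h) → ∑ e Φ ≤ ∑ e Ψ
  ∑-mono-≤ {t = zero}  e Φ≤Ψ = Φ≤Ψ []
  ∑-mono-≤ {t = suc t} e Φ≤Ψ = sum-mono-≤ λ i → ∑-mono-≤ (e ∘ punchIn i) λ en → Φ≤Ψ (i ∷ en)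

  ∑-+ : ∀ {n t} (e : Fin t → Fin n) Φ Ψ → ∑ e (λ h → Φ h + Ψ h) ≈ ∑ e Φ + ∑ e Ψ
  ∑-+ {t = zero}  e Φ Ψ = refl
  ∑-+ {t = suc t} e Φ Ψ = trans
    (sum-cong-≋ λ i → ∑-+ (e ∘ punchIn i) (λ h → Φ (e i ∷ h)) (λ h → Ψ (e i ∷ h)))
    (∑-distrib-+ {suc t} (λ i → ∑ (e ∘ punchIn i) (λ h → Φ (e i ∷ h))) (λ i → ∑ (e ∘ punchIn i) (λ h → Ψ (e i ∷ h))))

  ∑-*ˡ : ∀ {n t} (e : Fin t → Fin n) a Φ → ∑ e (λ h → a * Φ h) ≈ a * ∑ e Φ
  ∑-*ˡ {t = zero}  e a Φ = refl
  ∑-*ˡ {t = suc t} e a Φ = trans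
    (sum-cong-≋ λ i → ∑-*ˡ (e ∘ punchIn i) a (λ h → Φ (e i ∷ h)))
    (sym (*-distribˡ-sum {suc t} a (λ i → ∑ (e ∘ punchIn i) (λ h → Φ (e i ∷ h)))))

  ∑-const : ∀ {n t} (e : Fin t → Fin n) a → ∑ e (λ _ → a) ≈ fromℕ (t !) * a
  ∑-const {t = zero}  e a = trans (sym (*-identityˡ a)) (*-congʳ (sym fromℕ-1))
  ∑-const {t = suc t} e a = begin-equality
    sum (λ i → ∑ (e ∘ punchIn i) (λ _ → a))   ≈⟨ sum-cong-≋ (λ i → ∑-const (e ∘ punchIn i) a) ⟩
    sum {suc t} (λ i → fromℕ (t !) * a)       ≈⟨ sum-const (suc t) _ ⟩
    fromℕ (suc t) * (fromℕ (t !) * a)         ≈⟨ *-assoc _ _ _ ⟨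
    fromℕ (suc t) * fromℕ (t !) * a           ≈⟨ *-congʳ (fromℕ-* (suc t) (t !)) ⟨
    fromℕ (suc t !) * a                       ∎
    where open ≤R

  listSum : List Carrier → Carrier
  listSum = List.foldr _+_ 0#

  listSum-++ : ∀ xs ys → listSum (xs ++ ys) ≈ listSum xs + listSum ys
  listSum-++ [] ys = sym (+-identityˡ _)
  listSum-++ (x ∷ xs) ys = trans (+-congˡ (listSum-++ xs ys)) (sym (+-assoc x _ _))

  -- Stated for `List.tabulate k` because the tail of `allFin` is a tabulation of `suc`; this lets
  -- the induction go through.
  listSum-concatMap : ∀ {a b} {A : Set a} {B : Set b} (Ψ : B → Carrier) (g : A → List B) {t} (k : Fin t → A) →
    listSum (List.map Ψ (concatMap g (List.tabulate k))) ≈ sum (λ i → listSum (List.map Ψ (g (k i))))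
  listSum-concatMap Ψ g {zero} k = refl
  listSum-concatMap Ψ g {suc t} k = trans (reflexive (≡.cong listSum (Listₚ.map-++ Ψ (g (k zero)) _)))
    (trans (listSum-++ (List.map Ψ (g (k zero))) _) (+-congˡ (listSum-concatMap Ψ g (k ∘ suc))))

  ∑-orders : ∀ {n t} (e : Fin t → Fin n) Φ → listSum (List.map (Φ ∘ Vec.map e) (orders t)) ≈ ∑ e Φ
  ∑-orders {t = zero}  e Φ = +-identityʳ _
  ∑-orders {t = suc t} e Φ = trans (listSum-concatMap (Φ ∘ Vec.map e) (λ i → List.map (insert i) (orders t)) {suc t} id) (sum-cong-≋ λ i →
    trans (reflexive (≡.cong listSum (≡.trans (≡.sym (Listₚ.map-∘ {g = Φ ∘ Vec.map e} {f = insert i} (orders t)))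
      (Listₚ.map-cong (λ σ → ≡.cong (λ h → Φ (e i ∷ h)) (≡.sym (Vecₚ.map-∘ e (punchIn i) σ))) (orders t)))))
    (∑-orders (e ∘ punchIn i) (λ h → Φ (e i ∷ h))))
    where
    insert : Fin (suc t) → Vec (Fin t) t → Vec (Fin (suc t)) (suc t)
    insert i σ = i ∷ Vec.map (punchIn i) σ

  listSum-orders : ∀ {n} (Φ : Vec (Fin n) n → Carrier) → listSum (List.map Φ (orders n)) ≈ ∑ id Φ
  listSum-orders {n} Φ = trans (reflexive (≡.cong listSum (Listₚ.map-cong (λ σ → ≡.cong Φ (≡.sym (Vecₚ.map-id σ))) (orders n)))) (∑-orders id Φ)

  fromℕ-length : ∀ {a} {A : Set a} (xs : List A) → fromℕ (List.length xs) ≈ listSum (List.map (λ _ → 1#) xs)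
  fromℕ-length [] = refl
  fromℕ-length (x ∷ xs) = +-congˡ (fromℕ-length xs)

  average-orders : ∀ {n} (Φ : Vec (Fin n) n → Carrier) → fromℕ (n !) * average (List.map Φ (orders n)) ≈ ∑ id Φ
  average-orders {n} Φ = begin-equality
    fromℕ (n !) * average xs             ≈⟨ *-congʳ length≈n! ⟨
    fromℕ (List.length xs) * average xs  ≈⟨ y*[x/y]≈x _ (<-≤-trans (fromℕ-pos (ℕₚ.1≤n! n)) (≤-reflexive (sym length≈n!))) ⟩
    listSum xs                           ≈⟨ listSum-orders Φ ⟩
    ∑ id Φ                               ∎
    where
    open ≤R
    xs = List.map Φ (orders n)
    length≈n! : fromℕ (List.length xs) ≈ fromℕ (n !)
    length≈n! = begin-equality
      fromℕ (List.length xs)                     ≈⟨ reflexive (≡.cong fromℕ (Listₚ.length-map Φ (orders n))) ⟩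
      fromℕ (List.length (orders n))             ≈⟨ fromℕ-length (orders n) ⟩
      listSum (List.map (λ _ → 1#) (orders n))   ≈⟨ listSum-orders {n} (λ _ → 1#) ⟩
      ∑ {n} id (λ _ → 1#)                        ≈⟨ ∑-const {n} id 1# ⟩
      fromℕ (n !) * 1#                           ≈⟨ *-identityʳ _ ⟩
      fromℕ (n !)                                ∎

  -- Maximum over subsets of bounded size

  ∈-subsets : ∀ {n} (S : Subset n) → S Listₘ.∈ subsets n
  ∈-subsets [] = here ≡.refl
  ∈-subsets (false ∷ S) = Listₘₚ.∈-++⁺ˡ (Listₘₚ.∈-map⁺ (false ∷_) (∈-subsets S))
  ∈-subsets (true ∷ S) = Listₘₚ.∈-++⁺ʳ _ (Listₘₚ.∈-map⁺ (true ∷_) (∈-subsets S))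

  module _ {n : ℕ} (k : ℕ) (f : SetFunction n) (S : Subset n) where
    open Data.List.Extrema totalOrder using (max; xs≤max; max≤v⁺; argmax-sel)

    private
      feasible? = λ (T : Subset n) → (T ⊆? S) ×-dec (∣ T ∣ ℕₚ.≤? k)
      feasible = List.filter feasible? (subsets n)

    ≤-maxWithin : ∀ {T} → T ⊆ S → ∣ T ∣ ℕ.≤ k → f T ≤ maxWithin k f S
    ≤-maxWithin {T} T⊆S ∣T∣≤k = All.lookup (xs≤max (f ⊥) (List.map f feasible))
      (Listₘₚ.∈-map⁺ f (Listₘₚ.∈-filter⁺ feasible? (∈-subsets T) (T⊆S , ∣T∣≤k)))

    maxWithin-≤ : ∀ {v} → (∀ T → f T ≤ v) → maxWithin k f S ≤ v
    maxWithin-≤ bound = max≤v⁺ (bound ⊥) (Allₚ.map⁺ (All.universal bound feasible))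

    maxWithin-attained : ∃[ T ] (T ⊆ S × ∣ T ∣ ℕ.≤ k × maxWithin k f S ≈ f T)
    maxWithin-attained with argmax-sel id (f ⊥) (List.map f feasible)
    ... | inj₁ eq = ⊥ , Subₚ.⊆-min S , ≡.subst (ℕ._≤ k) (≡.sym (Subₚ.∣⊥∣≡0 n)) ℕ.z≤n , reflexive eq
    ... | inj₂ max∈ with Listₘₚ.∈-map⁻ f max∈
    ...   | T , T∈ , eq with Listₘₚ.∈-filter⁻ feasible? {xs = subsets n} T∈
    ...     | _ , T⊆S , ∣T∣≤k = T , T⊆S , ∣T∣≤k , reflexive eq

  HasBases : ∀ {n} → ℕ → SetFunction n → Set ℓ₂
  HasBases m f = ∀ S → ∃[ T ] (T ⊆ S × ∣ T ∣ ℕ.≤ m × f S ≤ f T)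

  -- A maximiser `T` of `F` within `S` competes in the maximum that equals f(T), so f(T) ≥ F(T) =
  -- f(S).
  m-submodular⇒hasBases : ∀ {n m} {f : SetFunction n} → m -Submodular f → HasBases m f
  m-submodular⇒hasBases {m = m} {f} (_ , F , _ , f≈max) S =
    let T , T⊆S , ∣T∣≤m , eq = maxWithin-attained m F S in
    T , T⊆S , ∣T∣≤m , (begin
      f S             ≈⟨ f≈max S ⟩
      maxWithin m F S ≈⟨ eq ⟩
      F T             ≤⟨ ≤-maxWithin m F T Subₚ.⊆-refl ∣T∣≤m ⟩
      maxWithin m F T ≈⟨ f≈max T ⟨
      f T             ∎)
    where open ≤R

  -- A basis of `S` has at most m ≤ k items and so competes in the maximum; the size limit `k` costs
  -- no value.
  ≤-maxWithin-bases : ∀ {n m k} {f : SetFunction n} → m ℕ.≤ k → HasBases m f → ∀ S → f S ≤ maxWithin k f S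
  ≤-maxWithin-bases {k = k} {f} m≤k bases S = let T , T⊆S , ∣T∣≤m , le = bases S in
    ≤-trans le (≤-maxWithin k f S T⊆S (ℕₚ.≤-trans ∣T∣≤m m≤k))

  -- Counting items and weights

  ∣x∪p∣≤1+∣p∣ : ∀ {n} (x : Fin n) p → ∣ ⁅ x ⁆ ∪ p ∣ ℕ.≤ suc ∣ p ∣
  ∣x∪p∣≤1+∣p∣ zero (true ∷ p) rewrite Subₚ.∪-identityˡ p = ℕₚ.n≤1+n _
  ∣x∪p∣≤1+∣p∣ zero (false ∷ p) rewrite Subₚ.∪-identityˡ p = ℕₚ.≤-refl
  ∣x∪p∣≤1+∣p∣ (suc x) (true ∷ p) = ℕ.s≤s (∣x∪p∣≤1+∣p∣ x p)
  ∣x∪p∣≤1+∣p∣ (suc x) (false ∷ p) = ∣x∪p∣≤1+∣p∣ x p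

  -- The factor that one decision contributes to 2^N, where N counts the candidates.
  weight : Bool → ℕ
  weight b = if b then 2 else 1

  sum-weight-≤2* : ∀ {t} (b : Fin t → Bool) → ℕΣ.sum (weight ∘ b) ℕ.≤ 2 ℕ.* t
  sum-weight-≤2* {zero} b = ℕ.z≤n
  sum-weight-≤2* {suc t} b = ℕₚ.≤-trans (ℕₚ.+-mono-≤ (weight≤2 (b zero)) (sum-weight-≤2* (b ∘ suc))) (ℕₚ.≤-reflexive (≡.sym (ℕₚ.*-suc 2 t)))
    where
    weight≤2 : ∀ b → weight b ℕ.≤ 2
    weight≤2 true  = ℕₚ.≤-refl
    weight≤2 false = ℕₚ.n≤1+n 1

  -- By injectivity each item of `S` is met at most once, so at most |S| indices have weight 2. The
  -- induction deletes from `S` every item that it has counted.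
  sum-weight-≤+∣∣ : ∀ {n t} (e : Fin t → Fin n) → Injective _≡_ _≡_ e → ∀ S →
                    ℕΣ.sum (weight ∘ lookup S ∘ e) ℕ.≤ t ℕ.+ ∣ S ∣
  sum-weight-≤+∣∣ {t = zero} e inj S = ℕ.z≤n
  sum-weight-≤+∣∣ {t = suc t} e inj S with e zero ∈? S
  ... | no e₀∉S rewrite ∉⇒lookup≡false e₀∉S = ℕ.s≤s (sum-weight-≤+∣∣ (e ∘ suc) (Finₚ.suc-injective ∘ inj) S)
  ... | yes e₀∈S rewrite Vecₚ.[]=⇒lookup e₀∈S = begin
    2 ℕ.+ ℕΣ.sum (weight ∘ lookup S ∘ e ∘ suc)   ≡⟨ ≡.cong (2 ℕ.+_) (ℕΣ.sum-cong-≗ (λ i → ≡.cong weight (same i))) ⟩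
    2 ℕ.+ ℕΣ.sum (weight ∘ lookup S′ ∘ e ∘ suc)  ≤⟨ ℕₚ.+-monoʳ-≤ 2 (sum-weight-≤+∣∣ (e ∘ suc) (Finₚ.suc-injective ∘ inj) S′) ⟩
    2 ℕ.+ (t ℕ.+ ∣ S′ ∣)                         ≡⟨ ≡.cong suc (≡.sym (ℕₚ.+-suc t ∣ S′ ∣)) ⟩
    suc t ℕ.+ suc ∣ S′ ∣                         ≤⟨ ℕₚ.+-monoʳ-≤ (suc t) (Subₚ.x∈p⇒∣p-x∣<∣p∣ e₀∈S) ⟩
    suc t ℕ.+ ∣ S ∣                              ∎
    where
    open ℕₚ.≤-Reasoning
    S′ = S Sub.- e zero
    same : ∀ i → lookup S (e (suc i)) ≡ lookup S′ (e (suc i))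
    same i with e (suc i) ∈? S
    ... | yes ∈S = ≡.trans (Vecₚ.[]=⇒lookup ∈S) (≡.sym (Vecₚ.[]=⇒lookup (Subₚ.x∈p∧x≢y⇒x∈p-y ∈S λ eq → Finₚ.0≢1+n (≡.sym (inj eq)))))
    ... | no  ∉S = ≡.trans (∉⇒lookup≡false ∉S) (≡.sym (∉⇒lookup≡false (∉S ∘ proj₁ ∘ x∈p-y⁻)))

  -- The algorithm

  module Algorithm (u K : ℕ) where

    candidate : ∀ {t} → Vec ℕ (suc t) → (Subset (suc t) → Carrier) → Bool
    -- There are `t` earlier arrivals, so the test u ≤ t rejects exactly the first `u` arrivals. The
    -- bound `suc (Vec.sum ids)` exceeds every label seen, so pruning tries all of them.
    candidate {t} ids o = does (u ℕₚ.≤? t) ∧ Vec.head (prune ids o (suc (Vec.sum ids)))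

    -- The earlier candidates are recomputed from the present data: prefixing `outside` turns a set
    -- of earlier positions into a set of present positions with the same items.
    candidates : ∀ {t} → Vec ℕ t → (Subset t → Carrier) → ℕ
    candidates []       o = 0
    candidates (i ∷ is) o = (if candidate (i ∷ is) o then 1 else 0) ℕ.+ candidates is (o ∘ (outside ∷_))

    firstCandidates : OnlineAlgorithm
    firstCandidates (i ∷ is) o = candidate (i ∷ is) o ∧ (candidates is (o ∘ (outside ∷_)) <ᵇ K)

  -- The algorithm on a fixed instance

  module Analysis {n : ℕ} (I : Instance n) (u K : ℕ) where
    open Instance I
    open Algorithm u K
    open Pruning item item-injective f f-monotone

    isCandidate : ∀ {t} → Vec (Fin n) (suc t) → Bool
    isCandidate h = candidate (Vec.map item h) (f ∘ image h)

    #candidates : ∀ {t} → Vec (Fin n) t → ℕ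
    #candidates h = candidates (Vec.map item h) (f ∘ image h)

    allCandidates : ∀ {t} → Vec (Fin n) t → Subset n
    allCandidates []      = ⊥
    allCandidates (x ∷ h) = if isCandidate (x ∷ h) then ⁅ x ⁆ ∪ allCandidates h else allCandidates h

    selected : ∀ {t} → Vec (Fin n) t → Subset n
    selected h = image h (decisions firstCandidates I h)

    selected-size : ∀ {t} (h : Vec (Fin n) t) → ∣ selected h ∣ ℕ.≤ #candidates h × ∣ selected h ∣ ℕ.≤ K
    selected-size [] rewrite Subₚ.∣⊥∣≡0 n = ℕ.z≤n , ℕ.z≤n
    selected-size (x ∷ h) with isCandidate (x ∷ h)
    ... | false = selected-size h
    ... | true with #candidates h <ᵇ K in eq
    ...   | false = ℕₚ.m≤n⇒m≤1+n (proj₁ (selected-size h)) , proj₂ (selected-size h)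
    ...   | true = let size≤ = proj₁ (selected-size h) in
        ℕₚ.≤-trans (∣x∪p∣≤1+∣p∣ x _) (ℕ.s≤s size≤) ,
        ℕₚ.≤-trans (∣x∪p∣≤1+∣p∣ x _) (ℕₚ.≤-trans (ℕ.s≤s size≤) (ℕₚ.<ᵇ⇒< _ K (Equivalence.from T-≡ eq)))

    selected≡allCandidates : ∀ {t} (h : Vec (Fin n) t) → #candidates h ℕ.≤ K → selected h ≡ allCandidates h
    selected≡allCandidates [] _ = ≡.refl
    selected≡allCandidates (x ∷ h) le with isCandidate (x ∷ h)
    ... | false = selected≡allCandidates h le
    ... | true with #candidates h <ᵇ K in eq
    ...   | false = contradiction (≡.trans (≡.sym eq) (Equivalence.to T-≡ (ℕₚ.<⇒<ᵇ le))) λ ()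
    ...   | true  = ≡.cong (⁅ x ⁆ ∪_) (selected≡allCandidates h (ℕₚ.<⇒≤ le))

    #candidates-≤ : ∀ {t} (h : Vec (Fin n) t) → #candidates h ℕ.≤ t
    #candidates-≤ [] = ℕ.z≤n
    #candidates-≤ (x ∷ h) with isCandidate (x ∷ h)
    ... | true  = ℕ.s≤s (#candidates-≤ h)
    ... | false = ℕₚ.m≤n⇒m≤1+n (#candidates-≤ h)

    -- This is T(P) for P = `range e`; the sum of the labels plus 1 is the bound that `candidate`
    -- uses, whatever the order.
    core : ∀ {t} → (Fin t → Fin n) → Subset n
    core e = pruned (range e) (suc (ℕΣ.sum (item ∘ e)))

    -- The right-hand side does not mention `h`: given the later arrivals, the decision depends on
    -- which item comes last and not on the order before it.
    isCandidate-core : ∀ {t} {e : Fin (suc t) → Fin n} → Injective _≡_ _≡_ e → ∀ i {h} → Enumerates (e ∘ punchIn i) h →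
                       isCandidate (e i ∷ h) ≡ does (u ℕₚ.≤? t) ∧ lookup (core e) (e i)
    isCandidate-core {t} {e} inj i {h} en = ≡.cong (does (u ℕₚ.≤? t) ∧_)
      (≡.trans (≡.sym (lookup-image-head (e i) h new S)) (≡.cong (λ W → lookup W (e i)) same))
      where
      ids = Vec.map item (e i ∷ h)
      S = prune ids (f ∘ image (e i ∷ h)) (suc (Vec.sum ids))
      new : ∀ j → lookup h j ≢ e i
      new j eq = let k , eq′ = enumerates-lookup en j in Finₚ.punchInᵢ≢i i k (inj (≡.trans (≡.sym eq′) eq))
      same : image (e i ∷ h) S ≡ core e
      same = ≡.trans (image-prune (e i ∷ h) _) (≡.cong₂ pruned (enumerates-image {e = e} (i ∷ en)) (≡.cong suc (enumerates-sum item {e = e} (i ∷ en))))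

    open Recurrences u

    -- Exponential moment of the number of candidates

    module _ {m : ℕ} (bases : HasBases m f) where

      core-small : ∀ {t} (e : Fin t → Fin n) → ∣ core e ∣ ℕ.≤ m
      core-small {t} e = pruned-small bases (range e) _ λ x∈ →
        let i , eq = ∈-range⁻ e x∈ in ℕ.s≤s (≡.subst (λ x → item x ℕ.≤ _) eq (≤-sum i))
        where
        ≤-sum : ∀ i → item (e i) ℕ.≤ ℕΣ.sum (item ∘ e)
        ≤-sum = go (item ∘ e)
          where
          go : ∀ {t} (g : Fin t → ℕ) i → g i ℕ.≤ ℕΣ.sum g
          go g zero    = ℕₚ.m≤m+n _ _
          go g (suc i) = ℕₚ.≤-trans (go (g ∘ suc) i) (ℕₚ.m≤n+m _ (g zero))

      -- The last arrival multiplies 2^N by its weight, and the bound for the rest is the same for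
      -- every choice of it. The weights of the t + 1 choices sum to t + 1 if t < u, as none can be
      -- a candidate; to at most t + 1 + m if t > u, by the size of the core; and to at most 2(t +
      -- 1) if t = u. These are the factors of `mgfCoeff`.
      mgf-bound : ∀ {t} (e : Fin t → Fin n) → Injective _≡_ _≡_ e →
                  ∑ e (λ h → fromℕ (2 ℕ.^ #candidates h)) ≤ fromℕ (mgfCoeff m t)
      mgf-bound {zero} e inj = ≤-refl
      mgf-bound {suc t} e inj = begin
        ∑ e (λ h → fromℕ (2 ℕ.^ #candidates h))    ≤⟨ sum-mono-≤ step ⟩
        sum (λ i → fromℕ (w i) * fromℕ M)          ≈⟨ *-distribʳ-sum (fromℕ M) (fromℕ ∘ w) ⟨
        sum (fromℕ ∘ w) * fromℕ M                  ≈⟨ *-congʳ (fromℕ-sum w) ⟨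
        fromℕ (ℕΣ.sum w) * fromℕ M                 ≈⟨ fromℕ-* (ℕΣ.sum w) M ⟨
        fromℕ (ℕΣ.sum w ℕ.* M)                     ≤⟨ fromℕ-mono total-weight ⟩
        fromℕ (mgfCoeff m (suc t))                 ∎
        where
        open ≤R
        M = mgfCoeff m t
        w : Fin (suc t) → ℕ
        w i = weight (does (u ℕₚ.≤? t) ∧ lookup (core e) (e i))
        pow : ∀ b a → 2 ℕ.^ ((if b then 1 else 0) ℕ.+ a) ≡ weight b ℕ.* 2 ℕ.^ a
        pow true  a = ≡.refl
        pow false a = ≡.sym (ℕₚ.*-identityˡ _)
        step : ∀ i → ∑ (e ∘ punchIn i) (λ h → fromℕ (2 ℕ.^ #candidates (e i ∷ h))) ≤ fromℕ (w i) * fromℕ M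
        step i = begin
          ∑ (e ∘ punchIn i) (λ h → fromℕ (2 ℕ.^ #candidates (e i ∷ h)))
            ≤⟨ ∑-mono-≤ (e ∘ punchIn i) (λ {h} en → ≤-reflexive (trans
                 (reflexive (≡.cong fromℕ (≡.trans (pow (isCandidate (e i ∷ h)) _) (≡.cong (λ b → weight b ℕ.* 2 ℕ.^ #candidates h) (isCandidate-core inj i en)))))
                 (fromℕ-* (w i) _))) ⟩
          ∑ (e ∘ punchIn i) (λ h → fromℕ (w i) * fromℕ (2 ℕ.^ #candidates h))
            ≈⟨ ∑-*ˡ (e ∘ punchIn i) (fromℕ (w i)) _ ⟩
          fromℕ (w i) * ∑ (e ∘ punchIn i) (λ h → fromℕ (2 ℕ.^ #candidates h))
            ≤⟨ *-monoʳ-≤ _ (fromℕ-nonNeg (w i)) (mgf-bound (e ∘ punchIn i) (Finₚ.punchIn-injective i _ _ ∘ inj)) ⟩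
          fromℕ (w i) * fromℕ M ∎
        total-weight : ℕΣ.sum w ℕ.* M ℕ.≤ mgfCoeff m (suc t)
        total-weight with ℕₚ.<-cmp t u
        ... | tri≈ _ _ _ = ℕₚ.*-monoˡ-≤ M (sum-weight-≤2* (λ i → does (u ℕₚ.≤? t) ∧ lookup (core e) (e i)))
        ... | tri< t<u _ _ rewrite dec-false (u ℕₚ.≤? t) (ℕₚ.<⇒≱ t<u) = ℕₚ.*-monoˡ-≤ M (ℕₚ.≤-reflexive (ones (suc t)))
          where
          ones : ∀ s → ℕΣ.sum {s} (λ _ → 1) ≡ s
          ones zero    = ≡.refl
          ones (suc s) = ≡.cong suc (ones s)
        ... | tri> _ _ u<t rewrite dec-true (u ℕₚ.≤? t) (ℕₚ.<⇒≤ u<t) =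
          ℕₚ.*-monoˡ-≤ M (ℕₚ.≤-trans (sum-weight-≤+∣∣ e inj (core e)) (ℕₚ.+-monoʳ-≤ (suc t) (core-small e)))

    -- Decay of the expected gap

    module _ (f-submodular : Submodular f) where

      gap : Subset n → Carrier
      gap S = f ⊤ - f S

      gap-+ : ∀ S → gap S + f S ≈ f ⊤
      gap-+ S = x-z+z≈x (f ⊤) (f S)

      gap-mono-f : ∀ {S T} → f S ≤ f T → gap T ≤ gap S
      gap-mono-f {S} {T} fS≤fT = +-cancelʳ-≤ (f S) (begin
        gap T + f S   ≤⟨ +-monoʳ-≤ (gap T) fS≤fT ⟩
        gap T + f T   ≈⟨ trans (gap-+ T) (sym (gap-+ S)) ⟩
        gap S + f S   ∎)
        where open ≤R

      gap-antitone : ∀ {S T} → S ⊆ T → gap T ≤ gap S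
      gap-antitone {S} {T} S⊆T = gap-mono-f (f-monotone S T S⊆T)

      gap-nonNeg : ∀ S → 0# ≤ gap S
      gap-nonNeg S = x≤y⇒0≤y-x (f-monotone S ⊤ Subₚ.⊆⊤)

      gap-supermodular : ∀ S T → gap S + gap T ≤ gap (S ∪ T) + gap (S ∩ T)
      gap-supermodular S T = +-cancelʳ-≤ (f (S ∪ T) + f (S ∩ T)) (begin
        (gap S + gap T) + (f (S ∪ T) + f (S ∩ T))              ≤⟨ +-monoʳ-≤ _ (f-submodular S T) ⟩
        (gap S + gap T) + (f S + f T)                          ≈⟨ total-gap S T ⟩
        f ⊤ + f ⊤                                              ≈⟨ total-gap (S ∪ T) (S ∩ T) ⟨
        (gap (S ∪ T) + gap (S ∩ T)) + (f (S ∪ T) + f (S ∩ T))  ∎)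
        where
        open ≤R
        total-gap : ∀ S T → (gap S + gap T) + (f S + f T) ≈ f ⊤ + f ⊤
        total-gap S T = trans (+P.interchange (gap S) (gap T) (f S) (f T)) (+-cong (gap-+ S) (gap-+ T))

      add : Subset n → Bool → Fin n → Subset n
      add A b x = if b then A ∪ ⁅ x ⁆ else A

      ⊆-add : ∀ A b x → A ⊆ add A b x
      ⊆-add A true  x = Subₚ.p⊆p∪q _
      ⊆-add A false x = Subₚ.⊆-refl

      -- The gains from adding the items of T ∩ range e to `A` one at a time sum to at least the
      -- gain from adding them all. The induction applies supermodularity of the gap to `A₀` and
      -- `B′`, whose union contains `B` and whose intersection contains `A`.
      gap-add-sum : ∀ {t} A (T : Subset n) (e : Fin t → Fin n) →
                    sum (λ i → gap (add A (lookup T (e i)) (e i))) + gap A ≤ gap (A ∪ (T ∩ range e)) + fromℕ t * gap A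
      gap-add-sum {zero} A T e = begin
        0# + gap A                             ≈⟨ +-identityˡ _ ⟩
        gap A                                  ≈⟨ reflexive (≡.cong gap (≡.sym (≡.trans (≡.cong (A ∪_) (Subₚ.∩-zeroʳ T)) (Subₚ.∪-identityʳ A)))) ⟩
        gap (A ∪ (T ∩ ⊥))                      ≤⟨ x≤x+y _ (*-nonNeg ≤-refl (gap-nonNeg A)) ⟩
        gap (A ∪ (T ∩ ⊥)) + 0# * gap A         ∎
        where open ≤R
      gap-add-sum {suc t} A T e = begin
        (gap A₀ + rest) + gap A                  ≈⟨ +-assoc _ _ _ ⟩
        gap A₀ + (rest + gap A)                  ≤⟨ +-monoʳ-≤ _ (gap-add-sum A T (e ∘ suc)) ⟩
        gap A₀ + (gap B′ + fromℕ t * gap A)      ≈⟨ +-assoc _ _ _ ⟨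
        (gap A₀ + gap B′) + fromℕ t * gap A      ≤⟨ +-monoˡ-≤ _ split ⟩
        (gap B + gap A) + fromℕ t * gap A        ≈⟨ +-assoc _ _ _ ⟩
        gap B + (gap A + fromℕ t * gap A)        ≈⟨ +-congˡ (trans (+-congʳ (sym (*-identityˡ _))) (sym (distribʳ _ _ _))) ⟩
        gap B + fromℕ (suc t) * gap A            ∎
        where
        open ≤R
        A₀ = add A (lookup T (e zero)) (e zero)
        rest = sum (λ i → gap (add A (lookup T (e (suc i))) (e (suc i))))
        B = A ∪ (T ∩ range e)
        B′ = A ∪ (T ∩ range (e ∘ suc))
        B⊆A₀∪B′ : B ⊆ A₀ ∪ B′
        B⊆A₀∪B′ x∈B with Subₚ.x∈p∪q⁻ A (T ∩ range e) x∈B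
        ... | inj₁ x∈A = Subₚ.x∈p∪q⁺ (inj₂ (Subₚ.p⊆p∪q _ x∈A))
        ... | inj₂ x∈T∩ with Subₚ.x∈p∩q⁻ T (range e) x∈T∩
        ...   | x∈T , x∈r with ∈-range⁻ e x∈r
        ...     | suc i , ≡.refl = Subₚ.x∈p∪q⁺ (inj₂ (Subₚ.q⊆p∪q A _ (Subₚ.x∈p∩q⁺ (x∈T , ∈-range⁺ (e ∘ suc) i))))
        ...     | zero , ≡.refl rewrite Vecₚ.[]=⇒lookup x∈T = Subₚ.p⊆p∪q _ (Subₚ.q⊆p∪q A _ (Subₚ.x∈⁅x⁆ (e zero)))
        split : gap A₀ + gap B′ ≤ gap B + gap A
        split = ≤-trans (gap-supermodular A₀ B′) (+-mono-≤ (gap-antitone B⊆A₀∪B′)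
          (gap-antitone λ x∈A → Subₚ.x∈p∩q⁺ (⊆-add A (lookup T (e zero)) (e zero) x∈A , Subₚ.p⊆p∪q _ x∈A)))

      -- Supermodularity of the gap is applied to A ∪ T and P. Their intersection contains T, which
      -- already has the full value of P; hence what P has beyond T adds no value on top of `A`
      -- either.
      gap-core : ∀ {t} A (e : Fin t → Fin n) → gap (A ∪ core e) ≤ gap (A ∪ range e)
      gap-core A e = +-cancelʳ-≤ (gap P) (begin
        gap (A ∪ T) + gap P                         ≤⟨ gap-supermodular (A ∪ T) P ⟩
        gap ((A ∪ T) ∪ P) + gap ((A ∪ T) ∩ P)       ≤⟨ +-mono-≤ (gap-antitone A∪P⊆) (gap-antitone T⊆) ⟩
        gap (A ∪ P) + gap T                         ≤⟨ +-monoʳ-≤ _ (gap-mono-f (f-pruned P _)) ⟩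
        gap (A ∪ P) + gap P                         ∎)
        where
        open ≤R
        P = range e
        T = core e
        A∪P⊆ : A ∪ P ⊆ (A ∪ T) ∪ P
        A∪P⊆ x∈ = Subₚ.x∈p∪q⁺ ([ (λ x∈A → inj₁ (Subₚ.p⊆p∪q T x∈A)) , inj₂ ]′ (Subₚ.x∈p∪q⁻ A P x∈))
        T⊆ : T ⊆ (A ∪ T) ∩ P
        T⊆ x∈ = Subₚ.x∈p∩q⁺ (Subₚ.q⊆p∪q A T x∈ , pruned-⊆ P _ x∈)

      -- Here `A` stands for the candidates among later arrivals, and `spans` is the invariant that
      -- the items of `e` complete it to full value. By `gap-core` the core alone does so, and the
      -- core remains within `A′ i` and the other items, so the invariant passes on. It also makes
      -- the first term on the right of `gap-add-sum` at most 0, so the t + 1 choices have total gap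
      -- at most t times that of `A`.
      gap-bound : ∀ {t} (e : Fin t → Fin n) → Injective _≡_ _≡_ e → ∀ A → gap (A ∪ range e) ≤ 0# →
                  ∑ e (λ h → gap (A ∪ allCandidates h)) ≤ fromℕ (gapCoeff t) * gap A
      gap-bound {t} e inj A spans with t ℕₚ.≤? u
      ... | yes t≤u = begin
        ∑ e (λ h → gap (A ∪ allCandidates h))   ≤⟨ ∑-mono-≤ e (λ _ → gap-antitone (Subₚ.p⊆p∪q _)) ⟩
        ∑ e (λ _ → gap A)                       ≈⟨ ∑-const e (gap A) ⟩
        fromℕ (t !) * gap A                     ≈⟨ *-congʳ (reflexive (≡.cong fromℕ (gapCoeff-≤u t t≤u))) ⟨
        fromℕ (gapCoeff t) * gap A              ∎
        where open ≤R
      gap-bound {zero} e inj A spans | no t≰u = contradiction ℕ.z≤n t≰u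
      gap-bound {suc t} e inj A spans | no t≰u = begin
        ∑ e (λ h → gap (A ∪ allCandidates h))   ≤⟨ sum-mono-≤ step ⟩
        sum (λ i → fromℕ C * gap (A′ i))        ≈⟨ *-distribˡ-sum (fromℕ C) (gap ∘ A′) ⟨
        fromℕ C * sum (gap ∘ A′)                ≤⟨ *-monoʳ-≤ _ (fromℕ-nonNeg C) drop ⟩
        fromℕ C * (fromℕ t * gap A)             ≈⟨ trans (sym (*-assoc _ _ _)) (*-congʳ (trans (*-comm _ _) (sym (fromℕ-* t C)))) ⟩
        fromℕ (t ℕ.* C) * gap A                 ≈⟨ *-congʳ (reflexive (≡.cong fromℕ (gapCoeff-step u≤t))) ⟨
        fromℕ (gapCoeff (suc t)) * gap A        ∎
        where
        open ≤R
        u≤t : u ℕ.≤ t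
        u≤t = ℕₚ.≤-pred (ℕₚ.≰⇒> t≰u)
        C = gapCoeff t
        A′ : Fin (suc t) → Subset n
        A′ i = add A (lookup (core e) (e i)) (e i)

        A∪core⊆ : ∀ i → A ∪ core e ⊆ A′ i ∪ range (e ∘ punchIn i)
        A∪core⊆ i x∈ with Subₚ.x∈p∪q⁻ A (core e) x∈
        ... | inj₁ x∈A = Subₚ.p⊆p∪q _ (⊆-add A _ _ x∈A)
        ... | inj₂ x∈T with range-punchIn e i (pruned-⊆ (range e) _ x∈T)
        ...   | inj₂ x∈r = Subₚ.q⊆p∪q (A′ i) _ x∈r
        ...   | inj₁ ≡.refl rewrite Vecₚ.[]=⇒lookup x∈T = Subₚ.p⊆p∪q _ (Subₚ.q⊆p∪q A _ (Subₚ.x∈⁅x⁆ (e i)))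

        move : ∀ b x S → A ∪ (if b then ⁅ x ⁆ ∪ S else S) ≡ add A b x ∪ S
        move true  x S = ≡.sym (Subₚ.∪-assoc A ⁅ x ⁆ S)
        move false x S = ≡.refl

        step : ∀ i → ∑ (e ∘ punchIn i) (λ h → gap (A ∪ allCandidates (e i ∷ h))) ≤ fromℕ C * gap (A′ i)
        step i = ≤-trans
          (∑-mono-≤ (e ∘ punchIn i) λ {h} en → ≤-reflexive (reflexive (≡.cong gap (≡.trans
            (move (isCandidate (e i ∷ h)) (e i) (allCandidates h))
            (≡.cong (λ b → add A b (e i) ∪ allCandidates h)
              (≡.trans (isCandidate-core inj i en) (≡.cong (_∧ lookup (core e) (e i)) (dec-true (u ℕₚ.≤? t) u≤t))))))))
          (gap-bound (e ∘ punchIn i) (Finₚ.punchIn-injective i _ _ ∘ inj) (A′ i)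
            (≤-trans (gap-antitone (A∪core⊆ i)) (≤-trans (gap-core A e) spans)))

        drop : sum (gap ∘ A′) ≤ fromℕ t * gap A
        drop = +-cancelʳ-≤ (gap A) (begin
          sum (gap ∘ A′) + gap A                                    ≤⟨ gap-add-sum A (core e) e ⟩
          gap (A ∪ (core e ∩ range e)) + fromℕ (suc t) * gap A      ≤⟨ +-monoˡ-≤ _ (≤-trans (gap-antitone covered) (≤-trans (gap-core A e) spans)) ⟩
          0# + fromℕ (suc t) * gap A                     ≈⟨ trans (+-identityˡ _) (distribʳ _ _ _) ⟩
          1# * gap A + fromℕ t * gap A                   ≈⟨ trans (+-comm _ _) (+-congˡ (*-identityˡ _)) ⟩
          fromℕ t * gap A + gap A                        ∎)
          where
          covered : A ∪ core e ⊆ A ∪ (core e ∩ range e)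
          covered x∈ = Subₚ.x∈p∪q⁺ ([ inj₁ , (λ x∈T → inj₂ (Subₚ.x∈p∩q⁺ (x∈T , pruned-⊆ (range e) _ x∈T))) ]′ (Subₚ.x∈p∪q⁻ A (core e) x∈))

      -- The weight q is 2^-(K+1), or 0 if n ≤ K, so that q 2^N bounds the indicator
      -- of an overflow; h is ε/2.
      ratio-bound : ∀ {m k} → m ℕ.≤ k → HasBases m f → ∀ {h q} → 0# ≤ q →
        (∀ {N} → K ℕ.< N → N ℕ.≤ n → 1# ≤ q * fromℕ (2 ℕ.^ N)) →
        fromℕ (gapCoeff n) * gap ⊥ ≤ fromℕ (n !) * h * f ⊤ →
        q * fromℕ (mgfCoeff m n) ≤ fromℕ (n !) * h →
        (1# - (h + h)) * f ⊤ ≤ ALG k firstCandidates I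
      ratio-bound {m} {k} m≤k bases {h} {q} 0≤q overflow gap-small overflow-rare =
        *-cancelˡ-≤ (fromℕ (n !)) (fromℕ-pos (ℕₚ.1≤n! n)) (+-cancelʳ-≤ (fromℕ (n !) * h * V + fromℕ (n !) * h * V) (begin
          fromℕ (n !) * ((1# - (h + h)) * V) + (fromℕ (n !) * h * V + fromℕ (n !) * h * V)    ≈⟨ collect ⟩
          fromℕ (n !) * V                                                                      ≈⟨ ∑-const {n} id V ⟨
          ∑ {n} id (λ _ → V)                                                                   ≤⟨ ∑-mono-≤ id (λ {σ} _ → pointwise σ) ⟩
          ∑ id (λ σ → value σ + (γ σ + V * q * pow σ))                                         ≈⟨ trans (∑-+ id value (λ σ → γ σ + V * q * pow σ)) (+-congˡ (trans (∑-+ id γ (λ σ → V * q * pow σ)) (+-congˡ (∑-*ˡ id (V * q) pow)))) ⟩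
          ∑ id value + (∑ id γ + V * q * ∑ id pow)                                             ≤⟨ +-monoʳ-≤ _ (+-mono-≤ (≤-trans (gap-bound id id ⊥ spans) gap-small) overflow-cost) ⟩
          ∑ id value + (fromℕ (n !) * h * V + fromℕ (n !) * h * V)                             ≈⟨ +-congʳ (average-orders value) ⟨
          fromℕ (n !) * ALG k firstCandidates I + (fromℕ (n !) * h * V + fromℕ (n !) * h * V)  ∎))
        where
        open ≤R
        V = f ⊤
        0≤V : 0# ≤ V
        0≤V = f-nonNegative ⊤
        value γ pow : Vec (Fin n) n → Carrier
        value σ = maxWithin k f (shortlist firstCandidates I σ)
        γ σ = gap (⊥ ∪ allCandidates σ)
        pow σ = fromℕ (2 ℕ.^ #candidates σ)

        spans : gap (⊥ ∪ range id) ≤ 0#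
        spans = ≤-trans (gap-antitone {⊤} λ {x} _ → Subₚ.q⊆p∪q ⊥ _ (∈-range⁺ id x)) (≤-reflexive (-‿inverseʳ V))

        overflow-cost : V * q * ∑ id pow ≤ fromℕ (n !) * h * V
        overflow-cost = begin
          V * q * ∑ id pow              ≈⟨ *-assoc _ _ _ ⟩
          V * (q * ∑ id pow)            ≤⟨ *-monoʳ-≤ V 0≤V (≤-trans (*-monoʳ-≤ q 0≤q (mgf-bound bases id id)) overflow-rare) ⟩
          V * (fromℕ (n !) * h)         ≈⟨ *-comm _ _ ⟩
          fromℕ (n !) * h * V           ∎

        pointwise : ∀ σ → V ≤ value σ + (γ σ + V * q * pow σ)
        -- Without overflow the shortlist is the set of all candidates, so its value and gap add up
        -- to V. With overflow the term V q 2^N is at least V by itself.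
        pointwise σ with #candidates σ ℕₚ.≤? K
        ... | yes N≤K = begin
          V                                     ≈⟨ gap-+ A ⟨
          gap A + f A                           ≈⟨ +-comm _ _ ⟩
          f A + gap A                           ≤⟨ +-mono-≤ fA≤value (x≤x+y _ (*-nonNeg (*-nonNeg 0≤V 0≤q) (fromℕ-nonNeg (2 ℕ.^ #candidates σ)))) ⟩
          value σ + (gap A + V * q * pow σ)     ≈⟨ +-congˡ (+-congʳ (reflexive (≡.cong gap (≡.sym (Subₚ.∪-identityˡ A))))) ⟩
          value σ + (γ σ + V * q * pow σ)       ∎
          where
          A = allCandidates σ
          fA≤value : f A ≤ value σ
          fA≤value = ≡.subst (λ S → f S ≤ value σ) (selected≡allCandidates σ N≤K) (≤-maxWithin-bases m≤k bases _)
        ... | no N≰K = begin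
          V                                  ≈⟨ *-identityʳ V ⟨
          V * 1#                             ≤⟨ *-monoʳ-≤ V 0≤V (overflow (ℕₚ.≰⇒> N≰K) (#candidates-≤ σ)) ⟩
          V * (q * pow σ)                    ≈⟨ *-assoc _ _ _ ⟨
          V * q * pow σ                      ≈⟨ trans (+-identityˡ _) (+-identityˡ _) ⟨
          0# + (0# + V * q * pow σ)          ≤⟨ +-mono-≤ (≤-trans (f-nonNegative _) (≤-maxWithin-bases m≤k bases (shortlist firstCandidates I σ))) (+-monoˡ-≤ _ (gap-nonNeg _)) ⟩
          value σ + (γ σ + V * q * pow σ)    ∎

        collect : fromℕ (n !) * ((1# - (h + h)) * V) + (fromℕ (n !) * h * V + fromℕ (n !) * h * V) ≈ fromℕ (n !) * V
        collect = begin-equality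
          a * (b * V) + (a * h * V + a * h * V)   ≈⟨ +-congˡ (+-cong (*-assoc a h V) (*-assoc a h V)) ⟩
          a * (b * V) + (a * (h * V) + a * (h * V)) ≈⟨ +-congˡ (distribˡ a _ _) ⟨
          a * (b * V) + a * (h * V + h * V)       ≈⟨ distribˡ a _ _ ⟨
          a * (b * V + (h * V + h * V))           ≈⟨ *-congˡ (+-congˡ (distribʳ V h h)) ⟨
          a * (b * V + (h + h) * V)               ≈⟨ *-congˡ (distribʳ V b (h + h)) ⟨
          a * ((b + (h + h)) * V)                 ≈⟨ *-congˡ (*-congʳ (x-z+z≈x 1# (h + h))) ⟩
          a * (1# * V)                            ≈⟨ *-congˡ (*-identityˡ V) ⟩
          a * V                                   ∎
          where
          a = fromℕ (n !)
          b = 1# - (h + h)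

  -- Choice of the parameters

  Achieves : ℕ → ℕ → ℕ → Carrier → Carrier → Set _
  Achieves m n k η ρ = Σ[ alg ∈ OnlineAlgorithm ]
    (∀ (I : Instance n) → m -Submodular (Instance.f I) → ShortlistSize≤ alg I η × RatioAtLeast k alg I ρ)

  achieves : ∀ {m n k ε η h q u K} → m ℕ.≤ k → ε ≤ 1# → ε ≈ h + h → fromℕ K ≤ η → 0# ≤ q →
    (∀ {N} → K ℕ.< N → N ℕ.≤ n → 1# ≤ q * fromℕ (2 ℕ.^ N)) →
    n ≡ 0 ⊎ fromℕ (Recurrences.gapCoeff u n) ≤ fromℕ (n !) * h →
    0# ≤ h →
    q * fromℕ (Recurrences.mgfCoeff u m n) ≤ fromℕ (n !) * h →
    Achieves m n k η (1# - ε)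
  achieves {m} {n} {k} {ε} {η} {h} {q} {u} {K} m≤k ε≤1 ε≈h+h K≤η 0≤q overflow gap-small 0≤h overflow-rare =
    Algorithm.firstCandidates u K , λ I f-m-submodular →
      let open Instance I
          open Analysis I u K
          open ≤R
          f-submodular = proj₁ f-m-submodular
          γ = gap f-submodular
          -- For n = 0 the coefficient is 1 and would exceed 0! times ε/2, but there ⊥ and ⊤
          -- coincide and the gap itself vanishes. Otherwise the gap of ⊥ is at most f(⊤), as f(⊥) ≥
          -- 0.
          gap-⊥-≤ = [ (λ { ≡.refl → ≤-trans (≤-reflexive (trans (*-congˡ (-‿inverseʳ (f ⊤))) (zeroʳ _))) (*-nonNeg (*-nonNeg (fromℕ-nonNeg (n !)) 0≤h) (f-nonNegative ⊤)) })
                    , (λ small → *-mono-≤ (gap-nonNeg f-submodular ⊥) (*-nonNeg (fromℕ-nonNeg (n !)) 0≤h) small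
                        (≤-respʳ-≈ (gap-+ f-submodular ⊥) (x≤x+y (γ ⊥) (f-nonNegative ⊥)))) ]′ gap-small
      in (λ σ _ → ≤-trans (fromℕ-mono (proj₂ (selected-size σ))) K≤η) ,
         (begin
           (1# - ε) * OPT k I          ≤⟨ *-monoʳ-≤ _ (x≤y⇒0≤y-x ε≤1) (maxWithin-≤ k f ⊤ λ T → f-monotone T ⊤ λ _ → Subₚ.∈⊤) ⟩
           (1# - ε) * f ⊤              ≈⟨ *-congʳ (+-congˡ (-‿cong ε≈h+h)) ⟩
           (1# - (h + h)) * f ⊤        ≤⟨ ratio-bound f-submodular m≤k (m-submodular⇒hasBases f-m-submodular) 0≤q overflow gap-⊥-≤ overflow-rare ⟩
           ALG k (Algorithm.firstCandidates u K) I ∎)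

  module Parameters {m : ℕ} {ε L : Carrier} (1≤m : 1 ℕ.≤ m) (0<ε : 0# < ε) (ε<1 : ε < 1#) (lnL : IsLn (fromℕ 2 / ε) L) where
    open ≤R
    r = fromℕ 2 / ε
    h = ε / fromℕ 2
    s = 2 ℕ.* m ℕ.+ 3
    0<2 : 0# < fromℕ 2
    0<2 = fromℕ-pos {2} (ℕ.s≤s ℕ.z≤n)
    0≤h : 0# ≤ h
    0≤h = *-nonNeg (<⇒≤ 0<ε) (⁻¹-nonNeg 0<2)
    ε≈h+h : ε ≈ h + h
    ε≈h+h = begin-equality
      ε               ≈⟨ y*[x/y]≈x ε 0<2 ⟨
      fromℕ 2 * h     ≈⟨ *-congʳ (+-congˡ fromℕ-1) ⟩
      (1# + 1#) * h   ≈⟨ distribʳ h 1# 1# ⟩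
      1# * h + 1# * h ≈⟨ +-cong (*-identityˡ h) (*-identityˡ h) ⟩
      h + h           ∎
    r*h≈1 : r * h ≈ 1#
    r*h≈1 = begin-equality
      (fromℕ 2 * ε ⁻¹) * (ε * fromℕ 2 ⁻¹)   ≈⟨ *-congˡ (*-comm _ _) ⟩
      (fromℕ 2 * ε ⁻¹) * (fromℕ 2 ⁻¹ * ε)   ≈⟨ *P.interchange _ _ _ _ ⟩
      (fromℕ 2 * fromℕ 2 ⁻¹) * (ε ⁻¹ * ε)   ≈⟨ *-cong (*-inverseʳ⁺ 0<2) (trans (*-comm _ _) (*-inverseʳ⁺ 0<ε)) ⟩
      1# * 1#                               ≈⟨ *-identityˡ 1# ⟩
      1#                                    ∎
    2<r : fromℕ 2 < r
    2<r = ≰⇒> λ r≤2 → <⇒≱ ε<1 (*-cancelˡ-≤ (fromℕ 2) 0<2 (begin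
      fromℕ 2 * 1#     ≈⟨ *-identityʳ _ ⟩
      fromℕ 2          ≈⟨ y*[x/y]≈x (fromℕ 2) 0<ε ⟨
      ε * r            ≤⟨ *-monoʳ-≤ ε (<⇒≤ 0<ε) r≤2 ⟩
      ε * fromℕ 2      ≈⟨ *-comm _ _ ⟩
      fromℕ 2 * ε      ∎))
    0<r : 0# < r
    0<r = <-≤-trans 0<2 (<⇒≤ 2<r)
    0≤L : 0# ≤ L
    0≤L = ln-nonNeg 2<r lnL
    n≰nh : ∀ {n} → 0 ℕ.< n → ¬ (fromℕ n ≤ fromℕ n * h)
    n≰nh {n} 0<n n≤nh = <⇒≱ ε<1 (begin
      1#      ≤⟨ *-cancelˡ-≤ (fromℕ n) (fromℕ-pos 0<n) (≤-respˡ-≈ (sym (*-identityʳ (fromℕ n))) n≤nh) ⟩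
      h       ≤⟨ x≤x+y h 0≤h ⟩
      h + h   ≈⟨ ε≈h+h ⟨
      ε       ∎)
    0≤sL : 0# ≤ fromℕ s * L
    0≤sL = *-nonNeg (fromℕ-nonNeg s) 0≤L

    r^[2+m]≤2^ : ∀ K → fromℕ s * L ≤ fromℕ (suc K) → r ^ (2 ℕ.+ m) ≤ fromℕ (2 ℕ.^ suc K)
    r^[2+m]≤2^ K = exp-^-≤-2^ (2 ℕ.+ m) s K 0<r lnL 0≤L (ℕ.s≤s ℕ.z≤n) (ℕₚ.≤-trans (ℕ.s≤s ℕ.z≤n) (ℕₚ.m≤n+m 3 (2 ℕ.* m))) (5d≤3s 1≤m)
      where
      5d≤3s : ∀ {m} → 1 ℕ.≤ m → 5 ℕ.* (2 ℕ.+ m) ℕ.≤ 3 ℕ.* (2 ℕ.* m ℕ.+ 3)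
      -- The inequality 5(m + 2) ≤ 3(2m + 3) amounts to m ≥ 1; the difference of the two sides is m
      -- - 1.
      5d≤3s {suc m} _ = ℕₚ.≤-trans (ℕₚ.m≤m+n _ m) (ℕₚ.≤-reflexive (e m))
        where
        e : ∀ m → 5 ℕ.* (2 ℕ.+ suc m) ℕ.+ m ≡ 3 ℕ.* (2 ℕ.* suc m ℕ.+ 3)
        e = solve-∀

    module _ {n u : ℕ} where
      open Recurrences u

      gapCoeff-small : 0 ℕ.< n → u ℕ.≤ n → fromℕ u ≤ fromℕ n * h → fromℕ (gapCoeff n) ≤ fromℕ (n !) * h
      gapCoeff-small 0<n u≤n u≤nh = *-cancelˡ-≤ (fromℕ n) (fromℕ-pos 0<n) (begin
        fromℕ n * fromℕ (gapCoeff n)   ≈⟨ fromℕ-* n (gapCoeff n) ⟨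
        fromℕ (n ℕ.* gapCoeff n)       ≈⟨ reflexive (≡.cong fromℕ (gapCoeff-≥u n u≤n)) ⟩
        fromℕ (u ℕ.* n !)              ≈⟨ fromℕ-* u (n !) ⟩
        fromℕ u * fromℕ (n !)          ≤⟨ *-monoˡ-≤ _ (fromℕ-nonNeg (n !)) u≤nh ⟩
        fromℕ n * h * fromℕ (n !)      ≈⟨ *P.xy∙z≈x∙zy _ _ _ ⟩
        fromℕ n * (fromℕ (n !) * h)    ∎)

      mgfCoeff-≤ : u ℕ.< n → fromℕ n * h ≤ fromℕ (suc u) → fromℕ (mgfCoeff m n) ≤ fromℕ 2 * fromℕ (n !) * r ^ m
      mgfCoeff-≤ u<n nh≤ = *-cancelˡ-≤ (fromℕ (suc u) ^ m) (^-pos (fromℕ-pos {suc u} (ℕ.s≤s ℕ.z≤n)) m) (begin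
        fromℕ (suc u) ^ m * fromℕ (mgfCoeff m n)              ≈⟨ trans (*-congʳ (sym (fromℕ-^ (suc u) m))) (*-comm _ _) ⟩
        fromℕ (mgfCoeff m n) * fromℕ (suc u ℕ.^ m)            ≤⟨ fromℕ-*-mono {mgfCoeff m n} {suc u ℕ.^ m} {2 ℕ.* n !} {n ℕ.^ m} (mgfCoeff->u m n u<n) ⟩
        fromℕ (2 ℕ.* n !) * fromℕ (n ℕ.^ m)                   ≈⟨ *-cong (fromℕ-* 2 (n !)) (fromℕ-^ n m) ⟩
        fromℕ 2 * fromℕ (n !) * fromℕ n ^ m                   ≤⟨ *-monoʳ-≤ _ (*-nonNeg (<⇒≤ 0<2) (fromℕ-nonNeg (n !))) (^-monoˡ-≤ m (fromℕ-nonNeg n) n≤r[1+u]) ⟩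
        fromℕ 2 * fromℕ (n !) * (fromℕ (suc u) * r) ^ m       ≈⟨ *-congˡ (^-distrib-* (fromℕ (suc u)) r m) ⟩
        fromℕ 2 * fromℕ (n !) * (fromℕ (suc u) ^ m * r ^ m)   ≈⟨ *P.x∙yz≈y∙xz _ _ _ ⟩
        fromℕ (suc u) ^ m * (fromℕ 2 * fromℕ (n !) * r ^ m)   ∎)
        where
        n≤r[1+u] : fromℕ n ≤ fromℕ (suc u) * r
        n≤r[1+u] = begin
          fromℕ n             ≈⟨ *-identityʳ _ ⟨
          fromℕ n * 1#        ≈⟨ *-congˡ (trans (*-comm h r) r*h≈1) ⟨
          fromℕ n * (h * r)   ≈⟨ *-assoc _ _ _ ⟨
          fromℕ n * h * r     ≤⟨ *-monoˡ-≤ r (<⇒≤ 0<r) nh≤ ⟩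
          fromℕ (suc u) * r   ∎

      -- The exponent m + 2 has three sources: r^m from the telescoped product, one `r` that
      -- dominates the factor 2, and one `r` that cancels `h`, since r h = 1.
      mgfCoeff-small : u ℕ.< n → fromℕ n * h ≤ fromℕ (suc u) → ∀ {Q} → r ^ (2 ℕ.+ m) ≤ fromℕ (2 ℕ.^ Q) →
                       fromℕ (mgfCoeff m n) ≤ fromℕ (2 ℕ.^ Q) * (fromℕ (n !) * h)
      mgfCoeff-small u<n nh≤ {Q} r^≤2^Q = begin
        fromℕ (mgfCoeff m n)                      ≤⟨ mgfCoeff-≤ u<n nh≤ ⟩
        fromℕ 2 * fromℕ (n !) * r ^ m             ≤⟨ *-monoˡ-≤ _ (^-nonNeg (<⇒≤ 0<r) m) (*-monoˡ-≤ _ (fromℕ-nonNeg (n !)) (<⇒≤ 2<r)) ⟩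
        r * fromℕ (n !) * r ^ m                   ≈⟨ *-identityʳ _ ⟨
        r * fromℕ (n !) * r ^ m * 1#              ≈⟨ *-congˡ r*h≈1 ⟨
        r * fromℕ (n !) * r ^ m * (r * h)         ≈⟨ rearrange ⟩
        r * (r * r ^ m) * (fromℕ (n !) * h)       ≤⟨ *-monoˡ-≤ _ (*-nonNeg (fromℕ-nonNeg (n !)) 0≤h) r^≤2^Q ⟩
        fromℕ (2 ℕ.^ Q) * (fromℕ (n !) * h)       ∎
        where
        rearrange : r * fromℕ (n !) * r ^ m * (r * h) ≈ r * (r * r ^ m) * (fromℕ (n !) * h)
        rearrange = begin-equality
          r * fromℕ (n !) * r ^ m * (r * h)     ≈⟨ *-congʳ (*P.xy∙z≈xz∙y _ _ _) ⟩
          r * r ^ m * fromℕ (n !) * (r * h)     ≈⟨ *P.interchange _ _ _ _ ⟩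
          r * r ^ m * r * (fromℕ (n !) * h)     ≈⟨ *-congʳ (*-comm _ _) ⟩
          r * (r * r ^ m) * (fromℕ (n !) * h)   ∎

    0*-≤ : ∀ {x y} → 0# ≤ y → 0# * x ≤ y
    0*-≤ 0≤y = ≤-respˡ-≈ (sym (zeroˡ _)) 0≤y

    n!h-nonNeg : ∀ n → 0# ≤ fromℕ (n !) * h
    n!h-nonNeg n = *-nonNeg (fromℕ-nonNeg (n !)) 0≤h

    achieved : ∀ n k → m ℕ.≤ k → Achieves m n k (fromℕ s * L) (1# - ε)
    achieved zero k m≤k = achieves {u = 0} {K = 0} m≤k (<⇒≤ ε<1) ε≈h+h 0≤sL ≤-refl
      (λ K<N N≤0 → contradiction (ℕₚ.≤-trans K<N N≤0) λ ()) (inj₁ ≡.refl) 0≤h (0*-≤ (n!h-nonNeg 0))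
    achieved n@(suc _) k m≤k
      -- `u` is the integer part of nε/2, and `K` that of (2m + 3)L cut off at `n`.
      with greatest (λ u → fromℕ u ≤? fromℕ n * h) (*-nonNeg (fromℕ-nonNeg n) 0≤h) n
         | greatest (λ K → fromℕ K ≤? fromℕ s * L) 0≤sL n
    ... | u , _ , u≤nh , inj₁ ≡.refl | _ = contradiction u≤nh (n≰nh {n} (ℕ.s≤s ℕ.z≤n))
    -- With capacity `n` the shortlist cannot overflow, so the weight q is 0. This also covers
    -- values of L above every natural number.
    ... | u , u≤n , u≤nh , inj₂ 1+u≰nh | K , _ , K≤sL , inj₁ ≡.refl =
          achieves {u = u} m≤k (<⇒≤ ε<1) ε≈h+h K≤sL ≤-refl (λ K<N N≤n → contradiction N≤n (ℕₚ.<⇒≱ K<N))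
            (inj₂ (gapCoeff-small (ℕ.s≤s ℕ.z≤n) u≤n u≤nh)) 0≤h (0*-≤ (n!h-nonNeg n))
    ... | u , u≤n , u≤nh , inj₂ 1+u≰nh | K , _ , K≤sL , inj₂ 1+K≰sL =
          achieves m≤k (<⇒≤ ε<1) ε≈h+h K≤sL (⁻¹-nonNeg 0<2^Q) overflow
            (inj₂ (gapCoeff-small (ℕ.s≤s ℕ.z≤n) u≤n u≤nh)) 0≤h rare
      where
      Q = suc K
      0<2^Q : 0# < fromℕ (2 ℕ.^ Q)
      0<2^Q = fromℕ-pos (ℕₚ.m^n>0 2 Q)
      q = fromℕ (2 ℕ.^ Q) ⁻¹
      overflow : ∀ {N} → K ℕ.< N → N ℕ.≤ n → 1# ≤ q * fromℕ (2 ℕ.^ N)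
      overflow {N} K<N _ = begin
        1#                     ≈⟨ *-inverseʳ⁺ 0<2^Q ⟨
        fromℕ (2 ℕ.^ Q) * q    ≈⟨ *-comm _ _ ⟩
        q * fromℕ (2 ℕ.^ Q)    ≤⟨ *-monoʳ-≤ q (⁻¹-nonNeg 0<2^Q) (fromℕ-mono (ℕₚ.^-monoʳ-≤ 2 K<N)) ⟩
        q * fromℕ (2 ℕ.^ N)    ∎
      u<n : u ℕ.< n
      u<n = ℕₚ.≤∧≢⇒< u≤n λ { ≡.refl → n≰nh {n} (ℕ.s≤s ℕ.z≤n) u≤nh }
      rare : q * fromℕ (Recurrences.mgfCoeff u m n) ≤ fromℕ (n !) * h
      rare = begin
        q * fromℕ (Recurrences.mgfCoeff u m n)        ≤⟨ *-monoʳ-≤ q (⁻¹-nonNeg 0<2^Q) (mgfCoeff-small u<n (≰⇒≥ 1+u≰nh) {Q} (r^[2+m]≤2^ K (≰⇒≥ 1+K≰sL))) ⟩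
        q * (fromℕ (2 ℕ.^ Q) * (fromℕ (n !) * h))     ≈⟨ *-assoc _ _ _ ⟨
        q * fromℕ (2 ℕ.^ Q) * (fromℕ (n !) * h)       ≈⟨ *-congʳ (trans (*-comm _ _) (*-inverseʳ⁺ 0<2^Q)) ⟩
        1# * (fromℕ (n !) * h)                        ≈⟨ *-identityˡ _ ⟩
        fromℕ (n !) * h                               ∎

theorem4 : ∀ {c ℓ₁ ℓ₂} (R : OrderedField c ℓ₁ ℓ₂) →
    let open OrderedField R
        open Shortlists R
    in
    (m : ℕ) → 1 ℕ.≤ m →
    (ε : Carrier) → 0# < ε → ε < 1# →
    (L : Carrier) → IsLn (fromℕ 2 / ε) L →
    (n k : ℕ) → m ℕ.≤ k →
    Σ[ alg ∈ OnlineAlgorithm ]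
      (∀ (I : Instance n) → m -Submodular (Instance.f I) →
        ShortlistSize≤ alg I (fromℕ (2 ℕ.* m ℕ.+ 3) * L) ×
        RatioAtLeast k alg I (1# - ε))
theorem4 R m 1≤m ε 0<ε ε<1 L lnL n k m≤k = SecretaryProof.Parameters.achieved R 1≤m 0<ε ε<1 lnL n k m≤k
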